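{- Let $q$ be a fixed prime power and $k\ge 2$ a fixed integer. Let $\mathfrak m=(m_1,\dots,m_k)$ and $\mathfrak n=(n_1,\dots,n_k)$ be $k$-tuples of nonnegative integers such that $m_k>0$, $n_k>0$ and $\max\{m_i,n_i\}>1$ for all $1\le i\le k-1$. Then $$P_k(\mathfrak m;\mathfrak n)=N_k(\mathfrak m)N_k(\mathfrak n)-q\,N_k(m_1,\dots,m_{k-1},m_k-1)\,N_k(n_1,\dots,n_{k-1},n_k-1)+O\Bigl(q^{\max_{1\le j\le k-1}\bigl(\frac{m_j}{m_j+1}\prod_{i=1}^k(m_i+1)+\frac{n_j}{n_j+1}\prod_{i=1}^k(n_i+1)\bigr)}\Bigr),$$ where the constant in the $O$-term is independent of $\mathfrak m$ and $\mathfrak n$ (it may depend on $q,k$).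
   Context: $\mathbb F_q$ is the finite field with $q$ elements. Two polynomials in $\mathbb F_q[x_1,\dots,x_k]$ are identified if they differ by a factor in $\mathbb F_q^\times$; the classes are called normalized polynomials. The vector degree of a nonzero $f$ is $\operatorname{Deg} f=(\deg_{x_1}f,\dots,\deg_{x_k}f)$. For a $k$-tuple $\mathfrak m$ of nonnegative integers, $\mathcal N_k(\mathfrak m)$ is the set of normalized polynomials $f\in\mathbb F_q[x_1,\dots,x_k]$ with $\operatorname{Deg} f=\mathfrak m$, and $N_k(\mathfrak m)=|\mathcal N_k(\mathfrak m)|$. $P_k(\mathfrak m;\mathfrak n)=|\{(f,g)\in\mathcal N_k(\mathfrak m)\times\mathcal N_k(\mathfrak n):\gcd(f,g)=1\}|$. -}

module Defs where

open import Level using (Level; _⊔_)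
open import Algebra.Apartness.Bundles using (HeytingField)
open import Algebra.Bundles using (RawMagma; CommutativeRing)
import Algebra.Definitions as AlgebraDefinitions
import Algebra.Definitions.RawMagma as RawMagmaDefinitions
open import Data.Bool.Base using (if_then_else_)
open import Data.Fin.Base using (Fin; zero; suc; inject₁; fromℕ)
import Data.List.Base as List
open import Data.List.Extrema.Nat using (max)
open import Data.Nat.Base as ℕ using (ℕ; zero; suc)
open import Data.Nat.DivMod using (_/_)
open import Data.Nat.ListAction using (product)
open import Data.Nat.Primality using (Prime)
import Data.Nat.Properties as ℕ
open import Data.Product.Base using (Σ-syntax; ∃-syntax; _×_; _,_; proj₁)
open import Data.Product.Relation.Binary.Pointwise.NonDependent using (×-setoid)
open import Data.Vec.Base as Vec using (Vec; []; _∷_; lookup; replicate; toList; _[_]%=_)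
open import Data.Vec.Properties using (≡-dec; lookup-replicate)
open import Function.Bundles using (Inverse)
open import Relation.Binary.Bundles using (Setoid)
import Relation.Binary.Construct.On as On
open import Relation.Binary.PropositionalEquality as ≡ using (_≡_)
import Relation.Binary.Reasoning.Setoid as SetoidReasoning
open import Relation.Nullary using (¬_; does; yes; no; contradiction)

IsPrimePower : ℕ → Set
IsPrimePower q = ∃[ p ] ∃[ r ] (Prime p × q ≡ p ℕ.^ suc r)

HasCardinality : ∀ {a ℓ} → Setoid a ℓ → ℕ → Set (a ⊔ ℓ)
HasCardinality S n = Inverse S (≡.setoid (Fin n))

-- A HeytingField in bijection with Fin q has decidable _≈_, and its _#_ is the
-- negation of _≈_ (both can be decided by searching for an inverse), so such
-- fields are exactly the fields with q elements.
module Polynomials {c ℓ₁ ℓ₂ : Level} (F : HeytingField c ℓ₁ ℓ₂) where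

  open HeytingField F
  open AlgebraDefinitions _≈_ using (Invertible)

  -- A polynomial in k variables is its family of coefficients, indexed by
  -- exponent vectors; the bound makes the support finite but, by the
  -- definition of _≋_ below, is not part of the identity of the polynomial.
  record Polynomial (k : ℕ) : Set (c ⊔ ℓ₁) where
    field
      coeff  : Vec ℕ k → Carrier
      bound  : ℕ
      vanish : ∀ α i → bound ℕ.< lookup α i → coeff α ≈ 0#

  open Polynomial public

  infix 4 _≋_ _∼_

  _≋_ : ∀ {k} → Polynomial k → Polynomial k → Set ℓ₁
  f ≋ g = ∀ α → coeff f α ≈ coeff g α

  -- The sum of h b c over all b, c with b + c = a.
  ∑ₙ : (a : ℕ) → (ℕ → ℕ → Carrier) → Carrier
  ∑ₙ zero    h = h 0 0
  ∑ₙ (suc a) h = h 0 (suc a) + ∑ₙ a (λ b c → h (suc b) c)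

  -- The sum of h β γ over all exponent vectors β, γ with β + γ = α.
  ∑ᵥ : ∀ {k} (α : Vec ℕ k) → (Vec ℕ k → Vec ℕ k → Carrier) → Carrier
  ∑ᵥ []      h = h [] []
  ∑ᵥ (a ∷ α) h = ∑ₙ a (λ b c → ∑ᵥ α (λ β γ → h (b ∷ β) (c ∷ γ)))

  ∑ₙ-zero : ∀ a {h : ℕ → ℕ → Carrier} → (∀ b c → b ℕ.+ c ≡ a → h b c ≈ 0#) → ∑ₙ a h ≈ 0#
  ∑ₙ-zero zero    p = p 0 0 ≡.refl
  ∑ₙ-zero (suc a) p =
    trans (+-cong (p 0 (suc a) ≡.refl)
                  (∑ₙ-zero a (λ b c e → p (suc b) c (≡.cong suc e))))
          (+-identityˡ 0#)

  ∑ᵥ-zero : ∀ {k} (α : Vec ℕ k) {h : Vec ℕ k → Vec ℕ k → Carrier} →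
            (∀ β γ → (∀ i → lookup β i ℕ.+ lookup γ i ≡ lookup α i) → h β γ ≈ 0#) →
            ∑ᵥ α h ≈ 0#
  ∑ᵥ-zero []      p = p [] [] (λ ())
  ∑ᵥ-zero (a ∷ α) p = ∑ₙ-zero a λ b c e → ∑ᵥ-zero α λ β γ es →
    p (b ∷ β) (c ∷ γ) λ { zero → e ; (suc i) → es i }

  infixl 7 _⊛_

  _⊛_ : ∀ {k} → Polynomial k → Polynomial k → Polynomial k
  coeff  (f ⊛ g) α = ∑ᵥ α (λ β γ → coeff f β * coeff g γ)
  bound  (f ⊛ g)   = bound f ℕ.+ bound g
  vanish (f ⊛ g) α i lt = ∑ᵥ-zero α λ β γ e → term β γ (e i)
    where
    term : ∀ β γ → lookup β i ℕ.+ lookup γ i ≡ lookup α i → coeff f β * coeff g γ ≈ 0#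
    term β γ e with bound f ℕ.<? lookup β i | bound g ℕ.<? lookup γ i
    ... | yes p | _     = trans (*-congʳ (vanish f β i p)) (zeroˡ _)
    ... | no  _ | yes p = trans (*-congˡ (vanish g γ i p)) (zeroʳ _)
    ... | no  p | no  r = contradiction lt
      (ℕ.≤⇒≯ (≡.subst (ℕ._≤ bound f ℕ.+ bound g) e (ℕ.+-mono-≤ (ℕ.≮⇒≥ p) (ℕ.≮⇒≥ r))))

  𝟙 : ∀ {k} → Polynomial k
  coeff  (𝟙 {k}) α = if does (≡-dec ℕ._≟_ α (replicate k 0)) then 1# else 0#
  bound  𝟙 = 0
  vanish (𝟙 {k}) α i lt with ≡-dec ℕ._≟_ α (replicate k 0)
  ... | no  _ = refl
  ... | yes e = contradiction (≡.sym (≡.trans (≡.cong (λ α → lookup α i) e) (lookup-replicate i 0)))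
                              (ℕ.<⇒≢ lt)

  polynomialRawMagma : ℕ → RawMagma (c ⊔ ℓ₁) ℓ₁
  polynomialRawMagma k = record { Carrier = Polynomial k ; _≈_ = _≋_ ; _∙_ = _⊛_ }

  open module PolynomialDivisibility {k} = RawMagmaDefinitions (polynomialRawMagma k) public
    using (_∣_)

  IsGCD : ∀ {k} → Polynomial k → Polynomial k → Polynomial k → Set (c ⊔ ℓ₁)
  IsGCD d f g = d ∣ f × d ∣ g × (∀ e → e ∣ f → e ∣ g → e ∣ d)

  -- gcd(f , g) = 1
  Coprime : ∀ {k} → Polynomial k → Polynomial k → Set (c ⊔ ℓ₁)
  Coprime = IsGCD 𝟙

  HasDegreeIn : ∀ {k} → Fin k → Polynomial k → ℕ → Set ℓ₁
  HasDegreeIn i f d = (∃[ α ] (¬ coeff f α ≈ 0# × lookup α i ≡ d))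
                    × (∀ α → ¬ coeff f α ≈ 0# → lookup α i ℕ.≤ d)

  -- f ≠ 0 and Deg f = 𝔪; the first conjunct only matters when k = 0.
  HasDeg : ∀ {k} → Polynomial k → Vec ℕ k → Set ℓ₁
  HasDeg f 𝔪 = (∃[ α ] ¬ coeff f α ≈ 0#) × (∀ i → HasDegreeIn i f (lookup 𝔪 i))

  -- f and g represent the same normalized polynomial.
  _∼_ : ∀ {k} → Polynomial k → Polynomial k → Set (c ⊔ ℓ₁)
  f ∼ g = ∃[ u ] (Invertible 1# _*_ u × (∀ α → coeff f α ≈ u * coeff g α))

  private
    ring : CommutativeRing c ℓ₁
    ring = record { isCommutativeRing = isCommutativeRing }

    open SetoidReasoning (CommutativeRing.setoid ring)

    ∼-refl : ∀ {k} {f : Polynomial k} → f ∼ f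
    ∼-refl = 1# , (1# , *-identityˡ 1# , *-identityˡ 1#) , λ α → sym (*-identityˡ _)

    ∼-sym : ∀ {k} {f g : Polynomial k} → f ∼ g → g ∼ f
    ∼-sym {f = f} {g} (u , (v , vu , uv) , p) = v , (u , uv , vu) , λ α → begin
      coeff g α             ≈⟨ *-identityˡ _ ⟨
      1# * coeff g α        ≈⟨ *-congʳ vu ⟨
      v * u * coeff g α     ≈⟨ *-assoc v u _ ⟩
      v * (u * coeff g α)   ≈⟨ *-congˡ (p α) ⟨
      v * coeff f α         ∎

    *-inverse : ∀ {u v u′ v′} → u′ * u ≈ 1# → v′ * v ≈ 1# → (v′ * u′) * (u * v) ≈ 1#
    *-inverse {u} {v} {u′} {v′} p r = begin
      (v′ * u′) * (u * v)   ≈⟨ *-assoc v′ u′ _ ⟩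
      v′ * (u′ * (u * v))   ≈⟨ *-congˡ (*-assoc u′ u v) ⟨
      v′ * (u′ * u * v)     ≈⟨ *-congˡ (*-congʳ p) ⟩
      v′ * (1# * v)         ≈⟨ *-congˡ (*-identityˡ v) ⟩
      v′ * v                ≈⟨ r ⟩
      1#                    ∎

    ∼-trans : ∀ {k} {f g h : Polynomial k} → f ∼ g → g ∼ h → f ∼ h
    ∼-trans {f = f} {g} {h} (u , (u′ , u′u , uu′) , p) (v , (v′ , v′v , vv′) , r) =
      u * v , (v′ * u′ , *-inverse u′u v′v , *-inverse vv′ uu′) , λ α → begin
        coeff f α           ≈⟨ p α ⟩
        u * coeff g α       ≈⟨ *-congˡ (r α) ⟩
        u * (v * coeff h α) ≈⟨ *-assoc u v _ ⟨
        u * v * coeff h α   ∎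

  normalized : ℕ → Setoid (c ⊔ ℓ₁) (c ⊔ ℓ₁)
  normalized k = record
    { Carrier       = Polynomial k
    ; _≈_           = _∼_
    ; isEquivalence = record
      { refl  = λ {f} → ∼-refl {f = f}
      ; sym   = λ {f g} → ∼-sym {f = f} {g}
      ; trans = λ {f g h} → ∼-trans {f = f} {g} {h}
      }
    }

  𝒩 : ∀ {k} → Vec ℕ k → Setoid (c ⊔ ℓ₁) (c ⊔ ℓ₁)
  𝒩 {k} 𝔪 = On.setoid {B = Σ[ f ∈ Polynomial k ] HasDeg f 𝔪} (normalized k) proj₁

  -- The setoid of coprime pairs in 𝒩 𝔪 × 𝒩 𝔫; its cardinality is P(𝔪 ; 𝔫).
  𝒫 : ∀ {k} → Vec ℕ k → Vec ℕ k → Setoid (c ⊔ ℓ₁) (c ⊔ ℓ₁)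
  𝒫 𝔪 𝔫 = On.setoid
    {B = Σ[ ((f , _) , (g , _)) ∈ Setoid.Carrier (𝒩 𝔪) × Setoid.Carrier (𝒩 𝔫) ] Coprime f g}
    (×-setoid (𝒩 𝔪) (𝒩 𝔫)) proj₁

open Polynomials public using (𝒩; 𝒫)

lowerLast : ∀ {k-1} → Vec ℕ (suc k-1) → Vec ℕ (suc k-1)
lowerLast {k-1} 𝔪 = 𝔪 [ fromℕ k-1 ]%= ℕ.pred

-- mⱼ/(mⱼ+1) · ∏ᵢ (mᵢ+1), the product running over all variables; the
-- division is exact because mⱼ+1 is one of the factors.
weight : ∀ {k} → Vec ℕ k → Fin k → ℕ
weight 𝔪 j = (lookup 𝔪 j ℕ.* product (toList (Vec.map suc 𝔪))) / suc (lookup 𝔪 j)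

-- The maximum is over all variables but the last. With at least two variables
-- the list is nonempty, so the default value 0 does not affect it.
errorExponent : ∀ {k-1} → Vec ℕ (suc k-1) → Vec ℕ (suc k-1) → ℕ
errorExponent {k-1} 𝔪 𝔫 =
  max 0 (List.tabulate {n = k-1} λ j → weight 𝔪 (inject₁ j) ℕ.+ weight 𝔫 (inject₁ j))

-- Write y for the last variable. A pair (f , g) has a unique decomposition
-- (h f₀ , h g₀) with h ∈ 𝔽[y] monic and (f₀ , g₀) without common factor in 𝔽[y]
-- up to constants. If h ≠ 1, write h = a + y h′ with h′ monic; then
-- (f , g) ↦ (a , h′ f₀ , h′ g₀) is a bijection, so exactly q N(𝔪 - eₖ) N(𝔫 - eₖ) pairs have h ≠ 1.
-- A non-coprime pair with h = 1 has a common divisor whose degree 𝔩 satisfies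
-- 𝔩ⱼ > 0 for some j < k. With M(𝔪) = ∏ᵢ (𝔪ᵢ + 1), superadditivity of M (up to 1) yields
--   M(𝔩) + M(𝔪 - 𝔩) + M(𝔫 - 𝔩) + ∑ᵢ 𝔩ᵢ ≤ weight 𝔪 j + weight 𝔫 j + 3,
-- and because of the term ∑ᵢ 𝔩ᵢ summing over all 𝔩 costs only a constant factor.
-- The asserted inequality is decidable, so h and the case distinctions are only
-- needed under a double negation, where they exist classically.

module Submission where

open import Defs
import Algebra.Properties.CommutativeSemigroup as CommutativeSemigroupProperties
import Algebra.Properties.Ring as RingProperties
open import Algebra.Apartness.Bundles using (HeytingField)
open import Algebra.Bundles using (CommutativeRing)
open import Data.Fin.Base using (Fin; zero; suc; inject₁; fromℕ; combine)
import Data.Fin.Properties as Fin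
import Data.Integer.Properties as ℤ
import Data.Integer.Tactic.RingSolver as ℤ
open import Data.List.Base as List using (List; length)
open import Data.List.Extrema.Nat using (xs≤max)
import Data.List.Properties as List
import Data.List.Relation.Unary.All.Properties as All
open import Data.Nat.Base as ℕ using (ℕ; zero; suc; z≤n; s≤s)
open import Data.Nat.DivMod using (_/_; m*n/n≡m)
open import Data.Nat.ListAction using (product)
import Data.Nat.Properties as ℕ
open import Data.Nat.Tactic.RingSolver using (solve-∀)
open import Data.Product.Base as Product using (∃; ∃-syntax; _×_; _,_; proj₁; proj₂)
open import Data.Product.Function.NonDependent.Propositional using (_×-↔_)
open import Data.Product.Properties using (,-injectiveˡ; ,-injectiveʳ)
open import Data.Sum.Base using (_⊎_; inj₁; inj₂; [_,_]; [_,_]′)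
open import Data.Sum.Function.Propositional using (_⊎-↔_)
open import Data.Sum.Properties using (inj₁-injective; inj₂-injective)
open import Data.Vec.Base as Vec
  using (Vec; []; _∷_; _∷ʳ_; init; last; initLast; lookup; removeAt; replicate; sum; tabulate; toList; zipWith)
open import Data.Vec.Properties
  using (≡-dec; init-∷ʳ; last-∷ʳ; lookup-replicate; lookup-zipWith; lookup∘tabulate;
         tabulate-cong; tabulate∘lookup; ∷ʳ-injective)
open import Function.Base using (_∘_)
open import Function.Bundles using (Inverse; _↔_)
open import Function.Construct.Composition using (_↔-∘_)
open import Function.Construct.Identity using (↔-id)
open import Level using (Level)
open import Relation.Binary.Bundles using (Setoid)
open import Relation.Binary.Definitions using (tri<; tri≈; tri>)
open import Relation.Binary.PropositionalEquality as ≡ using (_≡_; _≢_)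
import Relation.Binary.Reasoning.Setoid as SetoidReasoning
open import Relation.Nullary using (¬_; Dec; yes; no; contradiction)
open import Relation.Nullary.Decidable using (map′; ¬?; decidable-stable; ¬¬-excluded-middle)

-- Common factors in y alone have to be counted exactly: estimated like the others, 𝔩 = eₖ would
-- contribute the weight of the last variable, which the maximum in the error term leaves out. All
-- other common factors may be overcounted, so a pair is recorded by one common divisor and its two
-- cofactors, without regard to units or to the choice of the divisor. Accordingly no bijection is
-- built. Two injections between finite sets, one in each direction, give the two inequalities, and
-- each of them only has to be inverted up to scalars. The implied constant is q^(3+k). The 3 is
-- M(eⱼ) + 1, since the exponent inequality is an equality for 𝔩 = eⱼ; the k counts the end marks in
-- a unary code for 𝔩, whose remaining letters are the term ∑ᵢ 𝔩ᵢ. Uniqueness of h has to hold for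
-- the pair up to two independent scalars. It is therefore proved for whole families of polynomials
-- in y, where each member may be rescaled by itself.

to-injective : ∀ {a ℓ} (S : Setoid a ℓ) {n} (card : HasCardinality S n) {x y : Setoid.Carrier S} →
                  Inverse.to card x ≡ Inverse.to card y → Setoid._≈_ S x y
to-injective S card {x} {y} eq = S.trans (S.sym (strictlyInverseʳ x)) (S.trans (from-cong eq) (strictlyInverseʳ y))
  where module S = Setoid S
        open Inverse card

from-injective : ∀ {a ℓ} (S : Setoid a ℓ) {n} (card : HasCardinality S n) {i j : Fin n} →
                 Setoid._≈_ S (Inverse.from card i) (Inverse.from card j) → i ≡ j
from-injective S card {i} {j} eq = ≡.trans (≡.sym (strictlyInverseˡ i)) (≡.trans (to-cong eq) (strictlyInverseˡ j))
  where open Inverse card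

injection⇒≤ : ∀ {m n} {A B : Set} → Fin m ↔ A → Fin n ↔ B →
              (g : A → B) → (∀ x y → g x ≡ g y → x ≡ y) → m ℕ.≤ n
injection⇒≤ I J g g-injective = Fin.injective⇒≤ {f = J.from ∘ g ∘ I.to} λ {x} {y} eq →
  ≡.trans (≡.sym (I.strictlyInverseʳ x)) (≡.trans (≡.cong I.from (g-injective _ _
    (≡.trans (≡.sym (J.strictlyInverseˡ _)) (≡.trans (≡.cong J.to eq) (J.strictlyInverseˡ _)))))
    (I.strictlyInverseʳ y))
  where
  module I = Inverse I
  module J = Inverse J

-- This lets a classification of every pair of indices be chosen at once inside a double negation;
-- finiteness of the index set is essential.
¬¬-∀ : ∀ {a n} {A : Fin n → Set a} → (∀ i → ¬ ¬ A i) → ¬ ¬ (∀ i → A i)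
¬¬-∀ {n = zero}  h k = k λ ()
¬¬-∀ {n = suc n} h k = h zero λ a → ¬¬-∀ (h ∘ suc) λ as → k (Fin.∀-cons a as)

lookup-ext : ∀ {a} {A : Set a} {n} {xs ys : Vec A n} → (∀ i → lookup xs i ≡ lookup ys i) → xs ≡ ys
lookup-ext {xs = xs} {ys} e = ≡.trans (≡.sym (tabulate∘lookup xs)) (≡.trans (tabulate-cong e) (tabulate∘lookup ys))

greatest : ∀ {ℓ} {P : ℕ → Set ℓ} → (∀ n → Dec (P n)) → ∀ N → (∀ n → N ℕ.< n → ¬ P n) →
           ∃ P → ∃[ d ] (P d × (∀ n → d ℕ.< n → ¬ P n))
greatest P? N none (n , p) with P? N
... | yes pN = N , pN , none
greatest P? zero    none (zero  , p) | no ¬p = contradiction p ¬p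
greatest P? zero    none (suc n , p) | no ¬p = contradiction p (none (suc n) (s≤s z≤n))
greatest {P = P} P? (suc N) none (n , p) | no ¬p = greatest P? N none′ (n , p)
  where
  none′ : ∀ n → N ℕ.< n → ¬ P n
  none′ n lt with ℕ.m≤n⇒m<n∨m≡n lt
  ... | inj₁ lt′    = none n lt′
  ... | inj₂ ≡.refl = ¬p

-- Vectors split at the last entry

lookup-∷ʳ-fromℕ : ∀ {a} {A : Set a} {n} (xs : Vec A n) x → lookup (xs ∷ʳ x) (fromℕ n) ≡ x
lookup-∷ʳ-fromℕ []       x = ≡.refl
lookup-∷ʳ-fromℕ (_ ∷ xs) x = lookup-∷ʳ-fromℕ xs x

lookup-∷ʳ-inject₁ : ∀ {a} {A : Set a} {n} (xs : Vec A n) x i → lookup (xs ∷ʳ x) (inject₁ i) ≡ lookup xs i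
lookup-∷ʳ-inject₁ (_ ∷ xs) x zero    = ≡.refl
lookup-∷ʳ-inject₁ (_ ∷ xs) x (suc i) = lookup-∷ʳ-inject₁ xs x i

∷ʳ-mono : ∀ {n} (xs : Vec ℕ n) {x y} → x ℕ.≤ y → ∀ i → lookup (xs ∷ʳ x) i ℕ.≤ lookup (xs ∷ʳ y) i
∷ʳ-mono []       x≤y zero    = x≤y
∷ʳ-mono (_ ∷ xs) x≤y zero    = ℕ.≤-refl
∷ʳ-mono (_ ∷ xs) x≤y (suc i) = ∷ʳ-mono xs x≤y i

axis-+ : ∀ {n} x (v : Vec ℕ n) y → zipWith ℕ._+_ (replicate n 0 ∷ʳ x) (v ∷ʳ y) ≡ v ∷ʳ (x ℕ.+ y)
axis-+ x []      y = ≡.refl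
axis-+ x (a ∷ v) y = ≡.cong (a ∷_) (axis-+ x v y)

lowerLast-∷ʳ : ∀ {n} (v : Vec ℕ n) x → lowerLast (v ∷ʳ x) ≡ v ∷ʳ ℕ.pred x
lowerLast-∷ʳ []      x = ≡.refl
lowerLast-∷ʳ (a ∷ v) x = ≡.cong (a ∷_) (lowerLast-∷ʳ v x)

zipWith-+-cancelʳ : ∀ {n} (u v w : Vec ℕ n) → zipWith ℕ._+_ u w ≡ zipWith ℕ._+_ v w → u ≡ v
zipWith-+-cancelʳ u v w eq = lookup-ext λ i → ℕ.+-cancelʳ-≡ (lookup w i) (lookup u i) (lookup v i)
  (≡.trans (≡.sym (lookup-zipWith ℕ._+_ i u w)) (≡.trans (≡.cong (λ x → lookup x i) eq) (lookup-zipWith ℕ._+_ i v w)))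

replicate-∷ʳ-0 : ∀ k → replicate k 0 ∷ʳ 0 ≡ replicate (suc k) 0
replicate-∷ʳ-0 zero    = ≡.refl
replicate-∷ʳ-0 (suc k) = ≡.cong (0 ∷_) (replicate-∷ʳ-0 k)

-- Volumes of boxes and the exponent inequality

module _ where

  open import Data.Nat.Base using (_+_; _*_; _^_; _≤_; _<_; _⊔_)
  open import Relation.Binary.PropositionalEquality using (refl; sym; trans; cong)
  open import Data.List.Base using ([]; _∷_)

  -- The number of exponent vectors in the box below `v`, hence of the coefficients that a
  -- polynomial of degree `v` may have; this is M of the overview.
  volume : ∀ {k} → Vec ℕ k → ℕ
  volume v = product (toList (Vec.map suc v))

  volume-positive : ∀ {k} (v : Vec ℕ k) → 1 ≤ volume v
  volume-positive []      = ℕ.≤-refl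
  volume-positive (x ∷ v) = ℕ.≤-trans (volume-positive v) (ℕ.m≤m+n (volume v) _)

  -- The product of the factors 1 + xᵢ expands into 1, every single xᵢ and further nonnegative
  -- terms.
  sum<volume : ∀ {k} (v : Vec ℕ k) → sum v < volume v
  sum<volume []      = ℕ.≤-refl
  sum<volume (x ∷ v) = begin
    suc (x + sum v)           ≡⟨ rearrange x (sum v) ⟩
    suc (sum v) + x * 1       ≤⟨ ℕ.+-mono-≤ (sum<volume v) (ℕ.*-monoʳ-≤ x (volume-positive v)) ⟩
    volume v + x * volume v   ∎
    where
    open ℕ.≤-Reasoning
    rearrange : ∀ x s → suc (x + s) ≡ suc s + x * 1
    rearrange = solve-∀

  -- The box below `u` and the box below `v` translated by `u` both lie in the box below their sum
  -- and meet only in the corner `u`, which accounts for the 1.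
  volume-+ : ∀ {k} (u v : Vec ℕ k) → volume u + volume v ≤ volume (zipWith _+_ u v) + 1
  volume-+ []      []      = ℕ.≤-refl
  volume-+ (x ∷ u) (y ∷ v) = begin
    suc x * a + suc y * b             ≡⟨ expand x y a b ⟩
    (a + b) + (x * a + y * b)         ≤⟨ ℕ.+-mono-≤ a+b≤c+1 (ℕ.+-mono-≤ (ℕ.*-monoʳ-≤ x a≤c) (ℕ.*-monoʳ-≤ y b≤c)) ⟩
    (c + 1) + (x * c + y * c)         ≡⟨ collect x y c ⟩
    suc (x + y) * c + 1               ∎
    where
    open ℕ.≤-Reasoning
    a = volume u
    b = volume v
    c = volume (zipWith _+_ u v)
    a+b≤c+1 : a + b ≤ c + 1
    a+b≤c+1 = volume-+ u v
    a≤c : a ≤ c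
    a≤c = ℕ.+-cancelʳ-≤ 1 a c (ℕ.≤-trans (ℕ.+-monoʳ-≤ a (volume-positive v)) a+b≤c+1)
    b≤c : b ≤ c
    b≤c = ℕ.+-cancelʳ-≤ 1 b c (ℕ.≤-trans (ℕ.≤-reflexive (ℕ.+-comm b 1))
      (ℕ.≤-trans (ℕ.+-monoˡ-≤ b (volume-positive u)) a+b≤c+1))
    expand : ∀ x y a b → suc x * a + suc y * b ≡ (a + b) + (x * a + y * b)
    expand = solve-∀
    collect : ∀ x y c → (c + 1) + (x * c + y * c) ≡ suc (x + y) * c + 1
    collect = solve-∀

  volume-removeAt : ∀ {k} (v : Vec ℕ (suc k)) j → volume v ≡ suc (lookup v j) * volume (removeAt v j)
  volume-removeAt (x ∷ v)         zero    = refl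
  volume-removeAt (x ∷ v@(_ ∷ _)) (suc j) =
    trans (cong (suc x *_) (volume-removeAt v j)) (exchange (suc x) (suc (lookup v j)) (volume (removeAt v j)))
    where
    exchange : ∀ a b c → a * (b * c) ≡ b * (a * c)
    exchange = solve-∀

  sum-removeAt : ∀ {k} (v : Vec ℕ (suc k)) j → sum v ≡ lookup v j + sum (removeAt v j)
  sum-removeAt (x ∷ v)         zero    = refl
  sum-removeAt (x ∷ v@(_ ∷ _)) (suc j) =
    trans (cong (x +_) (sum-removeAt v j)) (exchange x (lookup v j) (sum (removeAt v j)))
    where
    exchange : ∀ a b c → a + (b + c) ≡ b + (a + c)
    exchange = solve-∀

  removeAt-zipWith : ∀ {k} (u v : Vec ℕ (suc k)) j →
                     removeAt (zipWith _+_ u v) j ≡ zipWith _+_ (removeAt u j) (removeAt v j)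
  removeAt-zipWith (_ ∷ _)         (_ ∷ _)         zero    = refl
  removeAt-zipWith (_ ∷ u@(_ ∷ _)) (_ ∷ v@(_ ∷ _)) (suc j) = cong (_ ∷_) (removeAt-zipWith u v j)

  -- Splitting off the factor of coordinate j makes the division exact. If that entry is positive,
  -- the result is the volume of `v` - eⱼ, the shape of a cofactor after dividing by a polynomial of
  -- degree eⱼ.
  weight-removeAt : ∀ {k} (v : Vec ℕ (suc k)) j → weight v j ≡ lookup v j * volume (removeAt v j)
  weight-removeAt v j = trans
    (cong (λ m → (lookup v j * m) / suc (lookup v j)) (volume-removeAt v j))
    (trans (cong (_/ suc (lookup v j)) (exchange (lookup v j) (volume (removeAt v j))))
           (m*n/n≡m (lookup v j * volume (removeAt v j)) (suc (lookup v j))))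
    where
    exchange : ∀ a b → a * (suc a * b) ≡ (a * b) * suc a
    exchange = solve-∀

  -- For s = a′ and A, B at their lower bounds, the sides differ by (t + x + y − 1) a′ + t (b′ + c′).
  exponentBound : ∀ t x y a′ b′ c′ s A B → 1 ≤ t + x + y → s ≤ a′ →
    suc b′ + suc a′ ≤ A + 1 → suc c′ + suc a′ ≤ B + 1 →
    suc (suc t) * suc a′ + suc x * suc b′ + suc y * suc c′ + (suc t + s) ≤ (x + suc t) * A + (y + suc t) * B + 3
  exponentBound t x y a′ b′ c′ s A B pos s≤a′ hA hB = ℕ.+-cancelʳ-≤ K _ _ (begin
    suc (suc t) * suc a′ + suc x * suc b′ + suc y * suc c′ + (suc t + s) + K
      ≤⟨ ℕ.+-monoˡ-≤ K (ℕ.+-monoʳ-≤ N (ℕ.+-monoʳ-≤ (suc t) s≤a′)) ⟩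
    L
      ≤⟨ ℕ.+-cancelʳ-≤ a′ _ _ step ⟩
    (x + suc t) * (suc b′ + suc a′) + (y + suc t) * (suc c′ + suc a′) + 3
      ≤⟨ ℕ.+-monoˡ-≤ 3 (ℕ.+-mono-≤ (ℕ.*-monoʳ-≤ (x + suc t) hA) (ℕ.*-monoʳ-≤ (y + suc t) hB)) ⟩
    (x + suc t) * (A + 1) + (y + suc t) * (B + 1) + 3
      ≡⟨ collect x y t A B ⟩
    (x + suc t) * A + (y + suc t) * B + 3 + K ∎)
    where
    open ℕ.≤-Reasoning
    K = (x + suc t) + (y + suc t)
    N = suc (suc t) * suc a′ + suc x * suc b′ + suc y * suc c′
    L = N + (suc t + a′) + K
    collect : ∀ x y t A B → (x + suc t) * (A + 1) + (y + suc t) * (B + 1) + 3 ≡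
                            (x + suc t) * A + (y + suc t) * B + 3 + ((x + suc t) + (y + suc t))
    collect = solve-∀
    expand : ∀ t x y a′ b′ c′ →
      suc (suc t) * suc a′ + suc x * suc b′ + suc y * suc c′ + (suc t + a′) + ((x + suc t) + (y + suc t))
        + ((t + x + y) * a′ + t * (b′ + c′))
      ≡ (x + suc t) * (suc b′ + suc a′) + (y + suc t) * (suc c′ + suc a′) + 3 + a′
    expand = solve-∀
    step : L + a′ ≤ (x + suc t) * (suc b′ + suc a′) + (y + suc t) * (suc c′ + suc a′) + 3 + a′
    step = begin
      L + a′                                          ≤⟨ ℕ.+-monoʳ-≤ L (ℕ.m≤n*m a′ (t + x + y) ⦃ ℕ.>-nonZero pos ⦄) ⟩
      L + (t + x + y) * a′                            ≤⟨ ℕ.+-monoʳ-≤ L (ℕ.m≤m+n _ (t * (b′ + c′))) ⟩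
      L + ((t + x + y) * a′ + t * (b′ + c′))          ≡⟨ expand t x y a′ b′ c′ ⟩
      (x + suc t) * (suc b′ + suc a′) + (y + suc t) * (suc c′ + suc a′) + 3 + a′ ∎

  -- With coordinate j split off, only three entries and the volumes and sums of the rest remain.
  -- For 𝔩 = eⱼ both sides agree, 3 being the volume 2 plus the sum 1. The hypothesis on the maximum
  -- rules out the entries 1, 0, 0 of `𝔩`, `𝔭`, `𝔯`, where the slack in `exponentBound` could be
  -- negative.
  factorizationBound : ∀ {k} (𝔩 𝔭 𝔯 : Vec ℕ (suc k)) j → 0 < lookup 𝔩 j →
    1 < lookup (zipWith _+_ 𝔭 𝔩) j ⊔ lookup (zipWith _+_ 𝔯 𝔩) j →
    volume 𝔩 + volume 𝔭 + volume 𝔯 + sum 𝔩 ≤ weight (zipWith _+_ 𝔭 𝔩) j + weight (zipWith _+_ 𝔯 𝔩) j + 3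
  factorizationBound 𝔩 𝔭 𝔯 j 0<l 1<max
    rewrite weight-removeAt (zipWith _+_ 𝔭 𝔩) j | weight-removeAt (zipWith _+_ 𝔯 𝔩) j
          | removeAt-zipWith 𝔭 𝔩 j | removeAt-zipWith 𝔯 𝔩 j
          | lookup-zipWith _+_ j 𝔭 𝔩 | lookup-zipWith _+_ j 𝔯 𝔩
          | volume-removeAt 𝔩 j | volume-removeAt 𝔭 j | volume-removeAt 𝔯 j | sum-removeAt 𝔩 j
    with lookup 𝔩 j | lookup 𝔭 j | lookup 𝔯 j
       | volume (removeAt 𝔩 j) | volume-positive (removeAt 𝔩 j) | sum<volume (removeAt 𝔩 j)
       | volume (removeAt 𝔭 j) | volume-positive (removeAt 𝔭 j) | volume-+ (removeAt 𝔭 j) (removeAt 𝔩 j)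
       | volume (removeAt 𝔯 j) | volume-positive (removeAt 𝔯 j) | volume-+ (removeAt 𝔯 j) (removeAt 𝔩 j)
  ... | suc t | x | y | suc a | _ | s≤s s≤a | suc b | _ | hA | suc c | _ | hB =
    exponentBound t x y a b c (sum (removeAt 𝔩 j)) _ _ (positive t x y 1<max) s≤a hA hB
    where
    positive : ∀ t x y → 1 < (x + suc t) ⊔ (y + suc t) → 1 ≤ t + x + y
    positive zero    zero    zero    (s≤s ())
    positive zero    zero    (suc y) _ = s≤s z≤n
    positive zero    (suc x) y       _ = s≤s z≤n
    positive (suc t) x       y       _ = s≤s z≤n

  weight≤errorExponent : ∀ {k} (𝔪 𝔫 : Vec ℕ (suc k)) (j : Fin k) →
                         weight 𝔪 (inject₁ j) + weight 𝔫 (inject₁ j) ≤ errorExponent 𝔪 𝔫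
  weight≤errorExponent {k} 𝔪 𝔫 j = All.tabulate⁻
    (xs≤max 0 (List.tabulate {n = k} λ j → weight 𝔪 (inject₁ j) + weight 𝔫 (inject₁ j))) j

  -- Words over an alphabet of q letters

  module Words {q : ℕ} (z o : Fin q) (z≢o : z ≢ o) where

    -- A self-delimiting code: the closing `z` of each entry lets the vector be read back whatever
    -- follows, at the price of `sum v` letters and one more per entry.
    unary : ∀ {k} → Vec ℕ k → List (Fin q) → List (Fin q)
    unary []          xs = xs
    unary (zero  ∷ v) xs = z ∷ unary v xs
    unary (suc a ∷ v) xs = o ∷ unary (a ∷ v) xs

    length-unary : ∀ {k} (v : Vec ℕ k) xs → length (unary v xs) ≡ sum v + k + length xs
    length-unary []                  xs = refl
    length-unary {suc k} (zero  ∷ v) xs = trans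
      (cong suc (length-unary v xs)) (cong (_+ length xs) (sym (ℕ.+-suc (sum v) k)))
    length-unary (suc a ∷ v)         xs = cong suc (length-unary (a ∷ v) xs)

    unary-injective : ∀ {k} (u v : Vec ℕ k) {xs ys} → unary u xs ≡ unary v ys → u ≡ v × xs ≡ ys
    unary-injective []          []          e = refl , e
    unary-injective (zero  ∷ u) (zero  ∷ v) e with unary-injective u v (List.∷-injectiveʳ e)
    ... | refl , e′ = refl , e′
    unary-injective (zero  ∷ u) (suc b ∷ v) e = contradiction (List.∷-injectiveˡ e) z≢o
    unary-injective (suc a ∷ u) (zero  ∷ v) e = contradiction (sym (List.∷-injectiveˡ e)) z≢o
    unary-injective (suc a ∷ u) (suc b ∷ v) e with unary-injective (a ∷ u) (b ∷ v) (List.∷-injectiveʳ e)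
    ... | refl , e′ = refl , e′

    shift : ∀ {k} → (Vec ℕ (suc k) → Fin q) → Vec ℕ (suc k) → Fin q
    shift f (b ∷ β) = f (suc b ∷ β)

    -- Only the values on the box below `v` are recorded. Their number depends on `v` alone, so
    -- blocks can be concatenated without separators once their vectors are known.
    write : ∀ {k} → Vec ℕ k → (Vec ℕ k → Fin q) → List (Fin q) → List (Fin q)
    write []          f xs = f [] ∷ xs
    write (zero  ∷ v) f xs = write v (f ∘ (0 ∷_)) xs
    write (suc a ∷ v) f xs = write v (f ∘ (0 ∷_)) (write (a ∷ v) (shift f) xs)

    length-write : ∀ {k} (v : Vec ℕ k) f xs → length (write v f xs) ≡ volume v + length xs
    length-write []          f xs = refl
    length-write (zero  ∷ v) f xs = trans (length-write v _ xs) (cong (_+ length xs) (sym (ℕ.+-identityʳ (volume v))))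
    length-write (suc a ∷ v) f xs = trans (length-write v _ _)
      (trans (cong (volume v +_) (length-write (a ∷ v) _ xs)) (sym (ℕ.+-assoc (volume v) _ _)))

    _≗[_]_ : ∀ {k} → (Vec ℕ k → Fin q) → Vec ℕ k → (Vec ℕ k → Fin q) → Set
    f ≗[ v ] g = ∀ α → (∀ i → lookup α i ≤ lookup v i) → f α ≡ g α

    ≗-zero : ∀ {k} {v : Vec ℕ k} {f g : Vec ℕ (suc k) → Fin q} → (f ∘ (0 ∷_)) ≗[ v ] (g ∘ (0 ∷_)) → f ≗[ 0 ∷ v ] g
    ≗-zero same (zero  ∷ α) le = same α (le ∘ suc)
    ≗-zero same (suc a ∷ α) le = contradiction (le zero) λ ()

    ≗-suc : ∀ {k a} {v : Vec ℕ k} {f g : Vec ℕ (suc k) → Fin q} →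
            (f ∘ (0 ∷_)) ≗[ v ] (g ∘ (0 ∷_)) → shift f ≗[ a ∷ v ] shift g → f ≗[ suc a ∷ v ] g
    ≗-suc same same′ (zero  ∷ α) le = same α (le ∘ suc)
    ≗-suc same same′ (suc b ∷ α) le = same′ (b ∷ α) λ { zero → ℕ.≤-pred (le zero) ; (suc i) → le (suc i) }

    write-injective : ∀ {k} (v : Vec ℕ k) {f g xs ys} → write v f xs ≡ write v g ys → f ≗[ v ] g × xs ≡ ys
    write-injective []          e = (λ { [] _ → List.∷-injectiveˡ e }) , List.∷-injectiveʳ e
    write-injective (zero  ∷ v) e = Product.map₁ ≗-zero (write-injective v e)
    write-injective (suc a ∷ v) {f} {g} e =
      Product.map₁ (≗-suc {f = f} {g} (proj₁ (write-injective v e)))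
                   (write-injective (a ∷ v) (proj₂ (write-injective v e)))

    index : ∀ N (xs : List (Fin q)) → length xs ≡ N → Fin (q ^ N)
    index zero    []       _ = zero
    index (suc N) (x ∷ xs) e = combine x (index N xs (ℕ.suc-injective e))

    index-injective : ∀ N xs ys {e e′} → index N xs e ≡ index N ys e′ → xs ≡ ys
    index-injective zero    []       []       _  = refl
    index-injective (suc N) (x ∷ xs) (y ∷ ys) eq with Fin.combine-injective x _ y _ eq
    ... | refl , eq′ = cong (x ∷_) (index-injective N xs ys eq′)

-- Finite fields and convolution sums

module FiniteField {c ℓ₁ ℓ₂ : Level} (F : HeytingField c ℓ₁ ℓ₂) {q : ℕ}
                   (card : HasCardinality (HeytingField.setoid F) q) where

  open HeytingField F hiding (setoid; zero)
  open Polynomials F hiding (𝒩; 𝒫)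

  commutativeRing : CommutativeRing c ℓ₁
  commutativeRing = record { isCommutativeRing = isCommutativeRing }

  open CommutativeRing commutativeRing using (setoid; ring; +-commutativeSemigroup; *-commutativeSemigroup)
  open RingProperties ring using (-0#≈0#; +-cancelˡ)
  open CommutativeSemigroupProperties +-commutativeSemigroup using () renaming (interchange to +-interchange)
  open CommutativeSemigroupProperties *-commutativeSemigroup using () renaming (x∙yz≈y∙xz to *-exchange)
  open SetoidReasoning setoid
  open Inverse card using (to-cong; strictlyInverseʳ) renaming (to to toFin; from to fromFin)

  _≟_ : ∀ x y → Dec (x ≈ y)
  x ≟ y = map′ (to-injective setoid card) to-cong (toFin x Fin.≟ toFin y)

  1≉0 : ¬ 1# ≈ 0#
  1≉0 1≈0 = #-irrefl 1≈0 (invertible⇒# (1# , 1-0 , trans (*-comm _ _) 1-0))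
    where
    1-0 : 1# * (1# - 0#) ≈ 1#
    1-0 = trans (*-identityˡ _) (trans (+-congˡ -0#≈0#) (+-identityʳ 1#))

  -- The inverse is found by searching the finite field. If the search fails, x cannot be apart from
  -- 0, and tightness of the apartness makes it equal to 0.
  reciprocal : ∀ {x} → ¬ x ≈ 0# → ∃[ y ] y * x ≈ 1#
  reciprocal {x} x≉0 with Fin.any? (λ j → (fromFin j * x) ≟ 1#)
  ... | yes (j , e) = fromFin j , e
  ... | no none = contradiction (proj₁ (tight x 0#) x¬#0) x≉0
    where
    x-0 : x - 0# ≈ x
    x-0 = trans (+-congˡ -0#≈0#) (+-identityʳ x)
    x¬#0 : ¬ x # 0#
    x¬#0 x#0 with #⇒invertible x#0
    ... | y , yx , _ = none (toFin y , trans (*-cong (strictlyInverseʳ y) (sym x-0)) yx)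

  nonzero-* : ∀ {x y} → ¬ x ≈ 0# → ¬ y ≈ 0# → ¬ x * y ≈ 0#
  nonzero-* {x} {y} x≉0 y≉0 xy≈0 with reciprocal x≉0
  ... | z , zx≈1 = y≉0 (begin
    y           ≈⟨ *-identityˡ y ⟨
    1# * y      ≈⟨ *-congʳ zx≈1 ⟨
    z * x * y   ≈⟨ *-assoc z x y ⟩
    z * (x * y) ≈⟨ *-congˡ xy≈0 ⟩
    z * 0#      ≈⟨ zeroʳ z ⟩
    0#          ∎)

  unit-nonzero : ∀ {x y} → x * y ≈ 1# → ¬ y ≈ 0#
  unit-nonzero xy≈1 y≈0 = 1≉0 (trans (sym xy≈1) (trans (*-congˡ y≈0) (zeroʳ _)))

  ∑ₙ-cong : ∀ a {h h′ : ℕ → ℕ → Carrier} → (∀ b c → b ℕ.+ c ≡ a → h b c ≈ h′ b c) → ∑ₙ a h ≈ ∑ₙ a h′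
  ∑ₙ-cong zero    e = e 0 0 ≡.refl
  ∑ₙ-cong (suc a) e = +-cong (e 0 (suc a) ≡.refl) (∑ₙ-cong a λ b c → e (suc b) c ∘ ≡.cong suc)

  ∑ₙ-single : ∀ b c {h : ℕ → ℕ → Carrier} →
              (∀ b′ c′ → b′ ℕ.+ c′ ≡ b ℕ.+ c → b′ ≢ b → h b′ c′ ≈ 0#) → ∑ₙ (b ℕ.+ c) h ≈ h b c
  ∑ₙ-single zero    zero    _ = refl
  ∑ₙ-single zero    (suc c) z = trans (+-congˡ (∑ₙ-zero c λ b c′ e → z (suc b) c′ (≡.cong suc e) λ ())) (+-identityʳ _)
  ∑ₙ-single (suc b) c       z = trans
    (+-cong (z 0 _ ≡.refl λ ()) (∑ₙ-single b c λ b′ c′ e ne → z (suc b′) c′ (≡.cong suc e) (ne ∘ ℕ.suc-injective)))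
    (+-identityˡ _)

  ∑ₙ-+ : ∀ a (h h′ : ℕ → ℕ → Carrier) → ∑ₙ a (λ b c → h b c + h′ b c) ≈ ∑ₙ a h + ∑ₙ a h′
  ∑ₙ-+ zero    h h′ = refl
  ∑ₙ-+ (suc a) h h′ = trans (+-congˡ (∑ₙ-+ a _ _)) (+-interchange _ _ _ _)

  ∑ₙ-*ˡ : ∀ a x (h : ℕ → ℕ → Carrier) → ∑ₙ a (λ b c → x * h b c) ≈ x * ∑ₙ a h
  ∑ₙ-*ˡ zero    x h = refl
  ∑ₙ-*ˡ (suc a) x h = trans (+-congˡ (∑ₙ-*ˡ a x _)) (sym (distribˡ x _ _))

  ∑ₙ-suc : ∀ a (h : ℕ → ℕ → Carrier) → ∑ₙ (suc a) h ≈ ∑ₙ a (λ b c → h b (suc c)) + h (suc a) 0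
  ∑ₙ-suc zero    h = refl
  ∑ₙ-suc (suc a) h = trans (+-congˡ (∑ₙ-suc a λ b c → h (suc b) c)) (sym (+-assoc _ _ _))

  ∑ₙ-swap : ∀ a (h : ℕ → ℕ → Carrier) → ∑ₙ a h ≈ ∑ₙ a (λ b c → h c b)
  ∑ₙ-swap zero    h = refl
  ∑ₙ-swap (suc a) h = trans (+-congˡ (∑ₙ-swap a λ b c → h (suc b) c))
    (trans (+-comm _ _) (sym (∑ₙ-suc a λ b c → h c b)))

  ∑ᵥ-cong : ∀ {k} (α : Vec ℕ k) {h h′ : Vec ℕ k → Vec ℕ k → Carrier} →
            (∀ β γ → (∀ i → lookup β i ℕ.+ lookup γ i ≡ lookup α i) → h β γ ≈ h′ β γ) → ∑ᵥ α h ≈ ∑ᵥ α h′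
  ∑ᵥ-cong []      e = e [] [] (λ ())
  ∑ᵥ-cong (a ∷ α) e = ∑ₙ-cong a λ b c p → ∑ᵥ-cong α λ β γ ps →
    e (b ∷ β) (c ∷ γ) λ { zero → p ; (suc i) → ps i }

  ∑ᵥ-swap : ∀ {k} (α : Vec ℕ k) (h : Vec ℕ k → Vec ℕ k → Carrier) → ∑ᵥ α h ≈ ∑ᵥ α (λ β γ → h γ β)
  ∑ᵥ-swap []      h = refl
  ∑ᵥ-swap (a ∷ α) h = trans (∑ₙ-cong a λ b c _ → ∑ᵥ-swap α _) (∑ₙ-swap a _)

  ⊛-comm : ∀ {k} (f g : Polynomial k) → f ⊛ g ≋ g ⊛ f
  ⊛-comm f g α = trans (∑ᵥ-swap α _) (∑ᵥ-cong α λ _ _ _ → *-comm _ _)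

  ⊛-cong : ∀ {k} {f f′ g g′ : Polynomial k} → f ≋ f′ → g ≋ g′ → f ⊛ g ≋ f′ ⊛ g′
  ⊛-cong f≋f′ g≋g′ α = ∑ᵥ-cong α λ β γ _ → *-cong (f≋f′ β) (g≋g′ γ)

  -- Univariate polynomials as coefficient sequences

  Sequence : Set c
  Sequence = ℕ → Carrier

  infix 4 _≐_
  _≐_ : Sequence → Sequence → Set ℓ₁
  s ≐ t = ∀ n → s n ≈ t n

  ≐-sym : ∀ {s t} → s ≐ t → t ≐ s
  ≐-sym e n = sym (e n)

  ≐-trans : ∀ {s t u} → s ≐ t → t ≐ u → s ≐ u
  ≐-trans e e′ n = trans (e n) (e′ n)

  infixl 7 _∗_
  infixl 6 _⊹_

  _∗_ _⊹_ : Sequence → Sequence → Sequence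
  (s ∗ t) n = ∑ₙ n (λ b c → s b * t c)
  (s ⊹ t) n = s n + t n

  ∗-cong : ∀ {s s′ t t′} → s ≐ s′ → t ≐ t′ → s ∗ t ≐ s′ ∗ t′
  ∗-cong e e′ n = ∑ₙ-cong n λ b c _ → *-cong (e b) (e′ c)

  ∗-distribʳ : ∀ u s t → (s ⊹ t) ∗ u ≐ s ∗ u ⊹ t ∗ u
  ∗-distribʳ u s t n = trans (∑ₙ-cong n λ _ _ _ → distribʳ _ _ _) (∑ₙ-+ n _ _)

  ∗-distribˡ : ∀ u s t → u ∗ (s ⊹ t) ≐ u ∗ s ⊹ u ∗ t
  ∗-distribˡ u s t n = trans (∑ₙ-cong n λ _ _ _ → distribˡ _ _ _) (∑ₙ-+ n _ _)

  ∗-scaleˡ : ∀ x s t → (λ n → x * s n) ∗ t ≐ (λ n → x * (s ∗ t) n)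
  ∗-scaleˡ x s t n = trans (∑ₙ-cong n λ _ _ _ → *-assoc _ _ _) (∑ₙ-*ˡ n x _)

  ∗-scaleʳ : ∀ x s t → s ∗ (λ n → x * t n) ≐ (λ n → x * (s ∗ t) n)
  ∗-scaleʳ x s t n = trans (∑ₙ-cong n λ _ _ _ → *-exchange _ _ _) (∑ₙ-*ˡ n x _)

  -- By definition (s ∗ t) ∘ suc is s 0 times t ∘ suc plus s ∘ suc ∗ t, so peeling off one
  -- coefficient leaves the same claim for s ∘ suc.
  ∗-assoc : ∀ s t u → (s ∗ t) ∗ u ≐ s ∗ (t ∗ u)
  ∗-assoc s t u zero    = *-assoc _ _ _
  ∗-assoc s t u (suc n) = begin
    s 0 * t 0 * u (suc n) + (((λ b → s 0 * t (suc b)) ⊹ s ∘ suc ∗ t) ∗ u) n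
      ≈⟨ +-cong (*-assoc _ _ _) (∗-distribʳ u _ _ n) ⟩
    s 0 * (t 0 * u (suc n)) + (((λ b → s 0 * t (suc b)) ∗ u) n + ((s ∘ suc ∗ t) ∗ u) n)
      ≈⟨ +-congˡ (+-cong (∗-scaleˡ _ _ u n) (∗-assoc _ t u n)) ⟩
    s 0 * (t 0 * u (suc n)) + (s 0 * (t ∘ suc ∗ u) n + (s ∘ suc ∗ (t ∗ u)) n)
      ≈⟨ +-assoc _ _ _ ⟨
    s 0 * (t 0 * u (suc n)) + s 0 * (t ∘ suc ∗ u) n + (s ∘ suc ∗ (t ∗ u)) n
      ≈⟨ +-congʳ (distribˡ _ _ _) ⟨
    s 0 * (t 0 * u (suc n) + (t ∘ suc ∗ u) n) + (s ∘ suc ∗ (t ∗ u)) n ∎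

  -- Kept apart from the sequence itself: the ring laws of `_∗_` hold for all power series, and only
  -- arguments by degree ask for a bound.
  Bounded : Sequence → Set ℓ₁
  Bounded s = ∃[ N ] (∀ n → N ℕ.≤ n → s n ≈ 0#)

  Degree : Sequence → ℕ → Set ℓ₁
  Degree s d = ¬ s d ≈ 0# × (∀ n → d ℕ.< n → s n ≈ 0#)

  Degree⇒Bounded : ∀ {s d} → Degree s d → Bounded s
  Degree⇒Bounded {d = d} (_ , z) = suc d , z

  -- The inequality d < N supplies the descent of the Euclidean algorithm when s is a remainder.
  zero⊎Degree : ∀ {s} N → (∀ n → N ℕ.≤ n → s n ≈ 0#) → (∀ n → s n ≈ 0#) ⊎ (∃[ d ] d ℕ.< N × Degree s d)
  zero⊎Degree zero    z = inj₁ λ n → z n z≤n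
  zero⊎Degree {s} (suc N) z with s N ≟ 0#
  ... | no  s≉0 = inj₂ (N , ℕ.≤-refl , s≉0 , z)
  ... | yes s≈0 with zero⊎Degree N (λ n N≤n →
    [ z n , (λ N≡n → trans (reflexive (≡.cong s (≡.sym N≡n))) s≈0) ]′ (ℕ.m≤n⇒m<n∨m≡n N≤n))
  ...   | inj₁ s≐0         = inj₁ s≐0
  ...   | inj₂ (d , d<N , deg) = inj₂ (d , ℕ.m<n⇒m<1+n d<N , deg)

  Degree-resp-≐ : ∀ {s t d} → s ≐ t → Degree s d → Degree t d
  Degree-resp-≐ e (nz , z) = (λ t≈0 → nz (trans (e _) t≈0)) , λ n lt → trans (sym (e n)) (z n lt)

  Degree-unique : ∀ {s d e} → Degree s d → Degree s e → d ≡ e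
  Degree-unique {d = d} {e} (nz , z) (nz′ , z′) with ℕ.<-cmp d e
  ... | tri< lt _ _ = contradiction (z e lt) nz′
  ... | tri≈ _ eq _ = eq
  ... | tri> _ _ gt = contradiction (z′ d gt) nz

  split-> : ∀ {b c d e} → d ℕ.+ e ℕ.< b ℕ.+ c → d ℕ.< b ⊎ e ℕ.< c
  split-> {b} {c} {d} {e} lt with d ℕ.<? b | e ℕ.<? c
  ... | yes p | _     = inj₁ p
  ... | no  _ | yes p = inj₂ p
  ... | no  p | no  r = contradiction lt (ℕ.≤⇒≯ (ℕ.+-mono-≤ (ℕ.≮⇒≥ p) (ℕ.≮⇒≥ r)))

  split-≢ : ∀ {b c d e} → b ℕ.+ c ≡ d ℕ.+ e → b ≢ d → d ℕ.< b ⊎ e ℕ.< c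
  split-≢ {b} {c} {d} {e} eq ne with d ℕ.<? b | e ℕ.<? c
  ... | yes p | _     = inj₁ p
  ... | no  _ | yes p = inj₂ p
  ... | no  p | no  r = contradiction eq (ℕ.<⇒≢ (ℕ.+-mono-<-≤ (ℕ.≤∧≢⇒< (ℕ.≮⇒≥ p) ne) (ℕ.≮⇒≥ r)))

  ∗-leading : ∀ {s t d e} → (∀ n → d ℕ.< n → s n ≈ 0#) → (∀ n → e ℕ.< n → t n ≈ 0#) →
              (s ∗ t) (d ℕ.+ e) ≈ s d * t e
  ∗-leading {d = d} {e} zs zt = ∑ₙ-single d e λ b c eq ne →
    [ (λ lt → trans (*-congʳ (zs b lt)) (zeroˡ _)) , (λ lt → trans (*-congˡ (zt c lt)) (zeroʳ _)) ]′ (split-≢ eq ne)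

  ∗-vanish : ∀ {s t d e} → (∀ n → d ℕ.< n → s n ≈ 0#) → (∀ n → e ℕ.< n → t n ≈ 0#) →
             ∀ n → d ℕ.+ e ℕ.< n → (s ∗ t) n ≈ 0#
  ∗-vanish zs zt n lt = ∑ₙ-zero n λ b c eq →
    [ (λ lt → trans (*-congʳ (zs b lt)) (zeroˡ _)) , (λ lt → trans (*-congˡ (zt c lt)) (zeroʳ _)) ]′
      (split-> (≡.subst (_ ℕ.<_) (≡.sym eq) lt))

  Degree-∗ : ∀ {s t d e} → Degree s d → Degree t e → Degree (s ∗ t) (d ℕ.+ e)
  Degree-∗ (s≉0 , zs) (t≉0 , zt) =
    (λ z → nonzero-* s≉0 t≉0 (trans (sym (∗-leading zs zt)) z)) , ∗-vanish zs zt

  -- Multiplication by a nonzero polynomial does not lower the top nonzero index,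
  -- so bounds on s ∗ t carry over to t.
  ∗-bound : ∀ {s t d} → Degree s d → Bounded t → ∀ m →
            (∀ n → m ℕ.≤ n → (s ∗ t) n ≈ 0#) → ∀ n → m ℕ.≤ n → t n ≈ 0#
  ∗-bound {d = d} ds (N , zt) m z with zero⊎Degree N zt
  ... | inj₁ t≐0 = λ n _ → t≐0 n
  ... | inj₂ (e , _ , dt) with m ℕ.≤? e
  ...   | yes m≤e = contradiction (z (d ℕ.+ e) (ℕ.≤-trans m≤e (ℕ.m≤n+m e d))) (proj₁ (Degree-∗ ds dt))
  ...   | no  m≰e = λ n m≤n → proj₂ dt n (ℕ.<-≤-trans (ℕ.≰⇒> m≰e) m≤n)

  ∗-constˡ : ∀ {s} t → Degree s 0 → s ∗ t ≐ (λ n → s 0 * t n)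
  ∗-constˡ {s} t (_ , z) n = ∑ₙ-single 0 n λ
    { zero    _ _ ne → contradiction ≡.refl ne
    ; (suc b) _ _ _  → trans (*-congʳ (z (suc b) (s≤s z≤n))) (zeroˡ _) }

  ∗-constʳ : ∀ s {t} → Degree t 0 → s ∗ t ≐ (λ n → s n * t 0)
  ∗-constʳ s {t} (_ , z) n = trans (∑ₙ-swap n _) (∑ₙ-single 0 n λ
    { zero    _ _ ne → contradiction ≡.refl ne
    ; (suc b) _ _ _  → trans (*-congˡ (z (suc b) (s≤s z≤n))) (zeroʳ _) })

  *-cancelʳ-nonzero : ∀ {x y z} → ¬ z ≈ 0# → x * z ≈ y * z → x ≈ y
  *-cancelʳ-nonzero {x} {y} {z} z≉0 e with reciprocal z≉0
  ... | w , wz≈1 = begin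
    x             ≈⟨ lemma x ⟨
    x * z * w     ≈⟨ *-congʳ e ⟩
    y * z * w     ≈⟨ lemma y ⟩
    y             ∎
    where
    lemma : ∀ x → x * z * w ≈ x
    lemma x = begin
      x * z * w   ≈⟨ *-assoc x z w ⟩
      x * (z * w) ≈⟨ *-congˡ (trans (*-comm z w) wz≈1) ⟩
      x * 1#      ≈⟨ *-identityʳ x ⟩
      x           ∎

  x≈y+[x-y] : ∀ x y → x ≈ y + (x - y)
  x≈y+[x-y] x y = begin
    x               ≈⟨ +-identityˡ x ⟨
    0# + x          ≈⟨ +-congʳ (-‿inverseʳ y) ⟨
    y - y + x       ≈⟨ +-assoc y (- y) x ⟩
    y + (- y + x)   ≈⟨ +-congˡ (+-comm (- y) x) ⟩
    y + (x - y)     ∎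

  x-y≈0 : ∀ {x y} → x ≈ y → x - y ≈ 0#
  x-y≈0 e = trans (+-congʳ e) (-‿inverseʳ _)

  Bounded-⊹ : ∀ {s t} → Bounded s → Bounded t → Bounded (s ⊹ t)
  Bounded-⊹ (N , zs) (M , zt) = N ℕ.⊔ M , λ n le →
    trans (+-cong (zs n (ℕ.≤-trans (ℕ.m≤m⊔n N M) le)) (zt n (ℕ.≤-trans (ℕ.m≤n⊔m N M) le))) (+-identityˡ 0#)

  Bounded-∗ : ∀ {s t} → Bounded s → Bounded t → Bounded (s ∗ t)
  Bounded-∗ {s} {t} (N , zs) (M , zt) =
    suc (N ℕ.+ M) , ∗-vanish {s} {t} (λ n lt → zs n (ℕ.<⇒≤ lt)) (λ n lt → zt n (ℕ.<⇒≤ lt))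

  Bounded-neg : ∀ {s} → Bounded s → Bounded (λ n → - s n)
  Bounded-neg (N , zs) = N , λ n le → trans (-‿cong (zs n le)) -0#≈0#

  monomial : ℕ → Carrier → Sequence
  monomial k x n with n ℕ.≟ k
  ... | yes _ = x
  ... | no  _ = 0#

  monomial-top : ∀ k x → monomial k x k ≈ x
  monomial-top k x with k ℕ.≟ k
  ... | yes _ = refl
  ... | no ne = contradiction ≡.refl ne

  monomial-vanish : ∀ k x n → k ℕ.< n → monomial k x n ≈ 0#
  monomial-vanish k x n lt with n ℕ.≟ k
  ... | yes eq = contradiction (≡.sym eq) (ℕ.<⇒≢ lt)
  ... | no _   = refl

  δ : Sequence
  δ = monomial 0 1#

  Degree-δ : Degree δ 0
  Degree-δ = 1≉0 , monomial-vanish 0 1#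

  ∗-identityˡ : ∀ s → δ ∗ s ≐ s
  ∗-identityˡ s n = trans (∗-constˡ s Degree-δ n) (*-identityˡ _)

  ∗-identityʳ : ∀ s → s ∗ δ ≐ s
  ∗-identityʳ s n = trans (∗-constʳ s Degree-δ n) (*-identityʳ _)

  -- Euclidean refinement and uniqueness of contents

  Family : Set → Set c
  Family I = I → Sequence

  BoundedFamily : {I : Set} → Family I → Set ℓ₁
  BoundedFamily f = ∀ i → Bounded (f i)

  -- Here `s` and `s′` stand for h′ / gcd(h , h′) and h / gcd(h , h′), without mention of a gcd.
  -- They are the same for all members of the families.
  record Refinement {I : Set} (h h′ : Sequence) (f f′ : Family I) : Set (c Level.⊔ ℓ₁) where
    field
      s s′     : Sequence
      t        : Family I
      bounded  : Bounded s
      bounded′ : Bounded s′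
      boundedᵗ : BoundedFamily t
      factor   : ∀ i → f i ≐ s ∗ t i
      factor′  : ∀ i → f′ i ≐ s′ ∗ t i
      cross    : h ∗ s ≐ h′ ∗ s′

  Refinement-swap : ∀ {I} {h h′} {f f′ : Family I} → Refinement h h′ f f′ → Refinement h′ h f′ f
  Refinement-swap r = record
    { s = s′ ; s′ = s ; t = t ; bounded = bounded′ ; bounded′ = bounded ; boundedᵗ = boundedᵗ
    ; factor = factor′ ; factor′ = factor ; cross = ≐-sym cross }
    where open Refinement r

  -- The Euclidean algorithm on (h , h′), carrying the two families along; this
  -- replaces unique factorization in 𝔽[y].
  refine : ∀ N {I} {h h′ d e} {f f′ : Family I} → d ℕ.+ e ℕ.< N → Degree h d → Degree h′ e →
           BoundedFamily f → BoundedFamily f′ → (∀ i → h ∗ f i ≐ h′ ∗ f′ i) → Refinement h h′ f f′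
  reduce : ∀ N {I} {h h′ d e} {f f′ : Family I} → d ℕ.+ e ℕ.≤ N → e ℕ.≤ d → Degree h d → Degree h′ e →
           BoundedFamily f → BoundedFamily f′ → (∀ i → h ∗ f i ≐ h′ ∗ f′ i) → Refinement h h′ f f′

  refine (suc N) {d = d} {e} (s≤s lt) dh dh′ bf bf′ eq with ℕ.≤-total e d
  ... | inj₁ e≤d = reduce N lt e≤d dh dh′ bf bf′ eq
  ... | inj₂ d≤e = Refinement-swap
    (reduce N (≡.subst (ℕ._≤ N) (ℕ.+-comm d e) lt) d≤e dh′ dh bf′ bf λ i → ≐-sym (eq i))

  reduce N {h = h} {h′} {d} {e} {f} {f′} lt e≤d dh dh′ bf bf′ eq = result
    where
    u : Carrier
    u = proj₁ (reciprocal (proj₁ dh′))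

    m r : Sequence
    -- A single step of long division, with the quotient of the leading terms. The remainder has
    -- degree below d but perhaps not below e, hence the induction on d + e.
    m = monomial (d ℕ.∸ e) (u * h d)
    r n = h n - (h′ ∗ m) n

    bm : Bounded m
    bm = _ , monomial-vanish (d ℕ.∸ e) (u * h d)

    top : h d ≈ (h′ ∗ m) d
    top = sym (begin
      (h′ ∗ m) d                  ≈⟨ reflexive (≡.cong (h′ ∗ m) (≡.sym (ℕ.m+[n∸m]≡n e≤d))) ⟩
      (h′ ∗ m) (e ℕ.+ (d ℕ.∸ e))  ≈⟨ ∗-leading (proj₂ dh′) (monomial-vanish _ _) ⟩
      h′ e * m (d ℕ.∸ e)          ≈⟨ *-congˡ (monomial-top (d ℕ.∸ e) _) ⟩
      h′ e * (u * h d)            ≈⟨ *-assoc _ _ _ ⟨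
      h′ e * u * h d              ≈⟨ *-congʳ (trans (*-comm _ _) (proj₂ (reciprocal (proj₁ dh′)))) ⟩
      1# * h d                    ≈⟨ *-identityˡ _ ⟩
      h d                         ∎)

    r-vanish : ∀ n → d ℕ.≤ n → r n ≈ 0#
    r-vanish n d≤n with ℕ.m≤n⇒m<n∨m≡n d≤n
    ... | inj₂ ≡.refl = x-y≈0 top
    ... | inj₁ d<n    = x-y≈0 (trans (proj₂ dh n d<n)
      (sym (∗-vanish (proj₂ dh′) (monomial-vanish _ _) n (≡.subst (ℕ._< n) (≡.sym (ℕ.m+[n∸m]≡n e≤d)) d<n))))

    h≐ : h ≐ h′ ∗ m ⊹ r
    h≐ n = x≈y+[x-y] _ _

    -- The families follow the division: h f = h′ f′ and h = h′ m + r give r f = h′ (f′ - m f).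
    g : Family _
    g i n = f′ i n - (m ∗ f i) n

    bg : BoundedFamily g
    bg i = Bounded-⊹ (bf′ i) (Bounded-neg {m ∗ f i} (Bounded-∗ {m} {f i} bm (bf i)))

    f′≐ : ∀ i → f′ i ≐ m ∗ f i ⊹ g i
    f′≐ i n = x≈y+[x-y] _ _

    eq′ : ∀ i → r ∗ f i ≐ h′ ∗ g i
    eq′ i n = +-cancelˡ (((h′ ∗ m) ∗ f i) n) _ _ (begin
      ((h′ ∗ m) ∗ f i) n + (r ∗ f i) n    ≈⟨ ∗-distribʳ (f i) (h′ ∗ m) r n ⟨
      ((h′ ∗ m ⊹ r) ∗ f i) n              ≈⟨ ∗-cong (≐-sym h≐) (λ _ → refl) n ⟩
      (h ∗ f i) n                         ≈⟨ eq i n ⟩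
      (h′ ∗ f′ i) n                       ≈⟨ ∗-cong (λ _ → refl) (f′≐ i) n ⟩
      (h′ ∗ (m ∗ f i ⊹ g i)) n            ≈⟨ ∗-distribˡ h′ (m ∗ f i) (g i) n ⟩
      (h′ ∗ (m ∗ f i)) n + (h′ ∗ g i) n   ≈⟨ +-congʳ (∗-assoc h′ m (f i) n) ⟨
      ((h′ ∗ m) ∗ f i) n + (h′ ∗ g i) n   ∎)

    result : Refinement h h′ f f′
    result with zero⊎Degree d r-vanish
    -- Here h′ divides h, and h′ g = r f = 0 forces g = 0, so that f′ = m f.
    ... | inj₁ r≐0 = record
      { s = δ ; s′ = m ; t = f ; bounded = Degree⇒Bounded {δ} Degree-δ ; bounded′ = bm ; boundedᵗ = bf
      ; factor = λ i → ≐-sym (∗-identityˡ (f i))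
      ; factor′ = λ i n → trans (f′≐ i n) (trans (+-congˡ (g≐0 i n)) (+-identityʳ _))
      ; cross = λ n → trans (∗-identityʳ h n) (trans (h≐ n) (trans (+-congˡ (r≐0 n)) (+-identityʳ _))) }
      where
      g≐0 : ∀ i n → g i n ≈ 0#
      g≐0 i n = ∗-bound dh′ (bg i) 0
        (λ n _ → trans (sym (eq′ i n)) (∑ₙ-zero n λ b _ _ → trans (*-congʳ (r≐0 b)) (zeroˡ _))) n z≤n
    ... | inj₂ (d′ , d′<d , dr) with refine N (ℕ.<-≤-trans (ℕ.+-monoˡ-< e d′<d) lt) dr dh′ bf bg eq′
    ...   | R = record
      { s = s ; s′ = m ∗ s ⊹ s′ ; t = t ; bounded = bounded
      ; bounded′ = Bounded-⊹ (Bounded-∗ {m} {s} bm bounded) bounded′ ; boundedᵗ = boundedᵗ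
      ; factor = factor
      ; factor′ = λ i n → begin
          f′ i n                               ≈⟨ f′≐ i n ⟩
          (m ∗ f i) n + g i n                  ≈⟨ +-cong (∗-cong (λ _ → refl) (factor i) n) (factor′ i n) ⟩
          (m ∗ (s ∗ t i)) n + (s′ ∗ t i) n     ≈⟨ +-congʳ (∗-assoc m s (t i) n) ⟨
          ((m ∗ s) ∗ t i) n + (s′ ∗ t i) n     ≈⟨ ∗-distribʳ (t i) (m ∗ s) s′ n ⟨
          ((m ∗ s ⊹ s′) ∗ t i) n               ∎
      ; cross = λ n → begin
          (h ∗ s) n                            ≈⟨ ∗-cong h≐ (λ _ → refl) n ⟩
          ((h′ ∗ m ⊹ r) ∗ s) n                 ≈⟨ ∗-distribʳ s (h′ ∗ m) r n ⟩
          ((h′ ∗ m) ∗ s) n + (r ∗ s) n         ≈⟨ +-cong (∗-assoc h′ m s n) (cross n) ⟩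
          (h′ ∗ (m ∗ s)) n + (h′ ∗ s′) n       ≈⟨ ∗-distribˡ h′ (m ∗ s) s′ n ⟨
          (h′ ∗ (m ∗ s ⊹ s′)) n                ∎ }
      where open Refinement R

  -- No common divisor in 𝔽[y] other than nonzero constants. A family of zeros does not qualify,
  -- because s = 0 divides it.
  Primitive : {I : Set} → Family I → Set (c Level.⊔ ℓ₁)
  Primitive f = ∀ s t → Bounded s → BoundedFamily t → (∀ i → f i ≐ s ∗ t i) → Degree s 0

  Monic : Sequence → ℕ → Set ℓ₁
  Monic h d = Degree h d × h d ≈ 1#

  -- In the refinement, primitivity of both families makes `s` and `s′` constants. Comparing the
  -- leading coefficients of the monic h and h′ in `cross` shows that these constants agree, and
  -- then they cancel.
  content-unique : ∀ {I} {h h′ d e} {f f′ : Family I} → Monic h d → Monic h′ e →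
    BoundedFamily f → BoundedFamily f′ → Primitive f → Primitive f′ →
    (∀ i → h ∗ f i ≐ h′ ∗ f′ i) → d ≡ e × h ≐ h′ × (∀ i → f i ≐ f′ i)
  content-unique {h = h} {h′} {d} {e} {f} {f′} (dh , h≈1) (dh′ , h′≈1) bf bf′ pf pf′ eq =
    d≡e , h≐h′ , λ i n → begin
      f i n          ≈⟨ factor i n ⟩
      (s ∗ t i) n    ≈⟨ ∗-constˡ (t i) ds n ⟩
      s 0 * t i n    ≈⟨ *-congʳ s≈s′ ⟩
      s′ 0 * t i n   ≈⟨ ∗-constˡ (t i) ds′ n ⟨
      (s′ ∗ t i) n   ≈⟨ factor′ i n ⟨
      f′ i n         ∎
    where
    open Refinement (refine (suc (d ℕ.+ e)) {f = f} {f′} ℕ.≤-refl dh dh′ bf bf′ eq)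

    ds : Degree s 0
    ds = pf s t bounded boundedᵗ factor

    ds′ : Degree s′ 0
    ds′ = pf′ s′ t bounded′ boundedᵗ factor′

    d≡e : d ≡ e
    d≡e = ≡.trans (≡.sym (ℕ.+-identityʳ d)) (≡.trans
      (Degree-unique (Degree-resp-≐ cross (Degree-∗ dh ds)) (Degree-∗ dh′ ds′)) (ℕ.+-identityʳ e))

    cross′ : ∀ n → h n * s 0 ≈ h′ n * s′ 0
    cross′ n = trans (sym (∗-constʳ h ds n)) (trans (cross n) (∗-constʳ h′ ds′ n))

    s≈s′ : s 0 ≈ s′ 0
    s≈s′ = begin
      s 0           ≈⟨ *-identityˡ _ ⟨
      1# * s 0      ≈⟨ *-congʳ h≈1 ⟨
      h d * s 0     ≈⟨ cross′ d ⟩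
      h′ d * s′ 0   ≈⟨ *-congʳ (trans (reflexive (≡.cong h′ d≡e)) h′≈1) ⟩
      1# * s′ 0     ≈⟨ *-identityˡ _ ⟩
      s′ 0          ∎

    h≐h′ : h ≐ h′
    h≐h′ n = *-cancelʳ-nonzero (proj₁ ds) (trans (cross′ n) (*-congˡ (sym s≈s′)))

  -- Degrees of products in several variables

  Nonzero : ∀ {k} → (Vec ℕ k → Carrier) → Set ℓ₁
  Nonzero f = ∃[ α ] ¬ f α ≈ 0#

  BoundedBy : ∀ {k} → ℕ → (Vec ℕ k → Carrier) → Set ℓ₁
  BoundedBy B f = ∀ α i → B ℕ.< lookup α i → f α ≈ 0#

  ¬Nonzero : ∀ {k} {f : Vec ℕ k → Carrier} → ¬ Nonzero f → ∀ α → f α ≈ 0#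
  ¬Nonzero {f = f} ¬nz α = decidable-stable (f α ≟ 0#) (λ f≉0 → ¬nz (α , f≉0))

  nonzero? : ∀ {k} B (f : Vec ℕ k → Carrier) → BoundedBy B f → Dec (Nonzero f)
  nonzero? {zero}  B f b = map′ ([] ,_) (λ { ([] , f≉0) → f≉0 }) (¬? (f [] ≟ 0#))
  nonzero? {suc k} B f b = map′ (λ { (a , _ , α , f≉0) → a ∷ α , f≉0 })
    (λ { (a ∷ α , f≉0) → a , a<sucB f≉0 , α , f≉0 })
    (ℕ.anyUpTo? (λ a → nonzero? B (f ∘ (a ∷_)) λ α i → b (a ∷ α) (suc i)) (suc B))
    where
    a<sucB : ∀ {a α} → ¬ f (a ∷ α) ≈ 0# → a ℕ.< suc B
    a<sucB {a} {α} f≉0 = s≤s (ℕ.≮⇒≥ (λ lt → f≉0 (b (a ∷ α) zero lt)))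

  leadingExponent : ∀ {k} B (f : Vec ℕ (suc k) → Carrier) → BoundedBy B f → Nonzero f →
                    ∃[ d ] (Nonzero (f ∘ (d ∷_)) × (∀ n → d ℕ.< n → ¬ Nonzero (f ∘ (n ∷_))))
  leadingExponent B f b (a ∷ α , f≉0) =
    greatest (λ a → nonzero? B (f ∘ (a ∷_)) λ α i → b (a ∷ α) (suc i)) B
             (λ n lt (α , f≉0) → f≉0 (b (n ∷ α) zero lt)) (a , α , f≉0)

  -- Induction on the number of variables with leading coefficients in the first one: at exponent d
  -- + e only the product of the two leading coefficients contributes.
  product-nonzero : ∀ {k} B B′ (f g : Vec ℕ k → Carrier) → BoundedBy B f → BoundedBy B′ g →
                    Nonzero f → Nonzero g → Nonzero (λ α → ∑ᵥ α (λ β γ → f β * g γ))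
  product-nonzero {zero}  B B′ f g bf bg ([] , f≉0) ([] , g≉0) = [] , nonzero-* f≉0 g≉0
  product-nonzero {suc k} B B′ f g bf bg nf ng
    with leadingExponent B f bf nf | leadingExponent B′ g bg ng
  ... | d , nf′ , zf | e , ng′ , zg
    with product-nonzero B B′ (f ∘ (d ∷_)) (g ∘ (e ∷_))
           (λ α i → bf (d ∷ α) (suc i)) (λ α i → bg (e ∷ α) (suc i)) nf′ ng′
  ...   | γ , nz = d ℕ.+ e ∷ γ , λ z → nz (trans (sym (∑ₙ-single d e vanishing)) z)
    where
    vanishing : ∀ b c → b ℕ.+ c ≡ d ℕ.+ e → b ≢ d → ∑ᵥ γ (λ β γ → f (b ∷ β) * g (c ∷ γ)) ≈ 0#
    vanishing b c eq ne with split-≢ eq ne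
    ... | inj₁ d<b = ∑ᵥ-zero γ λ β _ _ → trans (*-congʳ (¬Nonzero (zf b d<b) β)) (zeroˡ _)
    ... | inj₂ e<c = ∑ᵥ-zero γ λ _ γ _ → trans (*-congˡ (¬Nonzero (zg c e<c) γ)) (zeroʳ _)

  restrict : ∀ {k} → Fin k → ℕ → Polynomial k → Polynomial k
  coeff  (restrict i d f) α with lookup α i ℕ.≟ d
  ... | yes _ = coeff f α
  ... | no  _ = 0#
  bound  (restrict i d f) = bound f
  vanish (restrict i d f) α j lt with lookup α i ℕ.≟ d
  ... | yes _ = vanish f α j lt
  ... | no  _ = refl

  restrict-on : ∀ {k} (i : Fin k) {d} f {α} → lookup α i ≡ d → coeff (restrict i d f) α ≈ coeff f α
  restrict-on i {d} f {α} eq with lookup α i ℕ.≟ d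
  ... | yes _ = refl
  ... | no ne = contradiction eq ne

  restrict-off : ∀ {k} (i : Fin k) {d} f {α} → lookup α i ≢ d → coeff (restrict i d f) α ≈ 0#
  restrict-off i {d} f {α} ne with lookup α i ℕ.≟ d
  ... | yes eq = contradiction eq ne
  ... | no _   = refl

  restrict-nonzero : ∀ {k} (i : Fin k) {d} f {α} → ¬ coeff (restrict i d f) α ≈ 0# →
                     ¬ coeff f α ≈ 0# × lookup α i ≡ d
  restrict-nonzero i {d} f {α} nz with lookup α i ℕ.≟ d
  ... | yes eq = nz , eq
  ... | no _   = contradiction refl nz

  vanish-above : ∀ {k i} (f : Polynomial k) {d} → HasDegreeIn i f d → ∀ α → d ℕ.< lookup α i → coeff f α ≈ 0#
  vanish-above f (_ , le) α lt = decidable-stable (coeff f α ≟ 0#) (λ nz → ℕ.<⇒≱ lt (le α nz))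

  -- The product of the leading parts with respect to variable i is nonzero and consists of exactly
  -- the terms of f ⊛ g that have degree d + e in that variable.
  HasDegreeIn-⊛ : ∀ {k i} {f g : Polynomial k} {d e} →
                  HasDegreeIn i f d → HasDegreeIn i g e → HasDegreeIn i (f ⊛ g) (d ℕ.+ e)
  HasDegreeIn-⊛ {k} {i} {f} {g} {d} {e} df@((α , f≉0 , αᵢ≡d) , _) dg@((β , g≉0 , βᵢ≡e) , _)
    with product-nonzero (bound f) (bound g) (coeff (restrict i d f)) (coeff (restrict i e g))
           (vanish (restrict i d f)) (vanish (restrict i e g))
           (α , λ z → f≉0 (trans (sym (restrict-on i f αᵢ≡d)) z))
           (β , λ z → g≉0 (trans (sym (restrict-on i g βᵢ≡e)) z))
  ... | γ , nz = (γ , (λ z → nz (trans (sym same) z)) , γᵢ≡d+e) , λ α α≉0 → ℕ.≮⇒≥ λ lt →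
    α≉0 (∑ᵥ-zero α λ β γ es → term β γ (split-> (≡.subst (d ℕ.+ e ℕ.<_) (≡.sym (es i)) lt)))
    where
    term : ∀ β γ → d ℕ.< lookup β i ⊎ e ℕ.< lookup γ i → coeff f β * coeff g γ ≈ 0#
    term β γ (inj₁ lt) = trans (*-congʳ (vanish-above f df β lt)) (zeroˡ _)
    term β γ (inj₂ lt) = trans (*-congˡ (vanish-above g dg γ lt)) (zeroʳ _)

    off : ∀ β γ → (lookup β i ≡ d → lookup γ i ≢ e) → coeff (restrict i d f) β * coeff (restrict i e g) γ ≈ 0#
    off β γ ne with lookup β i ℕ.≟ d
    ... | no _   = zeroˡ _
    ... | yes eq = trans (*-congˡ (restrict-off i g {γ} (ne eq))) (zeroʳ _)

    γᵢ≡d+e : lookup γ i ≡ d ℕ.+ e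
    γᵢ≡d+e with lookup γ i ℕ.≟ d ℕ.+ e
    ... | yes eq = eq
    ... | no ne  = contradiction (∑ᵥ-zero γ λ β γ′ es → off β γ′ λ eq eq′ →
      ne (≡.trans (≡.sym (es i)) (≡.cong₂ ℕ._+_ eq eq′))) nz

    same : coeff (f ⊛ g) γ ≈ coeff (restrict i d f ⊛ restrict i e g) γ
    same = ∑ᵥ-cong γ λ β γ′ es → agree β γ′ (≡.trans (es i) γᵢ≡d+e)
      where
      agree : ∀ β γ → lookup β i ℕ.+ lookup γ i ≡ d ℕ.+ e →
              coeff f β * coeff g γ ≈ coeff (restrict i d f) β * coeff (restrict i e g) γ
      agree β γ eq with lookup β i ℕ.≟ d
      ... | yes β≡d = *-congˡ (sym (restrict-on i g {γ}
                        (ℕ.+-cancelˡ-≡ d _ _ (≡.trans (≡.cong (ℕ._+ _) (≡.sym β≡d)) eq))))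
      ... | no β≢d  = trans (term β γ (split-≢ eq β≢d)) (sym (zeroˡ _))

  HasDegreeIn-unique : ∀ {k i} {f g : Polynomial k} {d e} → f ≋ g → HasDegreeIn i f d → HasDegreeIn i g e → d ≡ e
  HasDegreeIn-unique f≋g ((α , f≉0 , ≡.refl) , le) ((β , g≉0 , ≡.refl) , le′) =
    ℕ.≤-antisym (le′ α (λ z → f≉0 (trans (f≋g α) z))) (le β (λ z → g≉0 (trans (sym (f≋g β)) z)))

  HasDegreeIn-exists : ∀ {k} i (f : Polynomial k) → Nonzero (coeff f) → ∃[ d ] HasDegreeIn i f d
  HasDegreeIn-exists i f (α , f≉0) with greatest
      (λ d → nonzero? (bound f) (coeff (restrict i d f)) (vanish (restrict i d f))) (bound f)
      (λ d lt (β , nz) → let (nz′ , eq) = restrict-nonzero i f nz in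
        nz′ (vanish f β i (≡.subst (bound f ℕ.<_) (≡.sym eq) lt)))
      (lookup α i , α , λ z → f≉0 (trans (sym (restrict-on i f ≡.refl)) z))
  ... | d , (β , nz) , none = d , (β , restrict-nonzero i f nz) ,
    λ γ nz → ℕ.≮⇒≥ λ lt → none (lookup γ i) lt (γ , λ z → nz (trans (sym (restrict-on i f ≡.refl)) z))

  HasDeg-exists : ∀ {k} (f : Polynomial k) → Nonzero (coeff f) → ∃[ 𝔪 ] HasDeg f 𝔪
  HasDeg-exists f nz = tabulate (λ i → proj₁ (HasDegreeIn-exists i f nz)) , nz ,
    λ i → ≡.subst (HasDegreeIn i f) (≡.sym (lookup∘tabulate _ i)) (proj₂ (HasDegreeIn-exists i f nz))

  HasDeg-unique : ∀ {k} {f g : Polynomial k} {𝔪 𝔫} → f ≋ g → HasDeg f 𝔪 → HasDeg g 𝔫 → 𝔪 ≡ 𝔫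
  HasDeg-unique {f = f} {g} f≋g (_ , df) (_ , dg) = lookup-ext λ i → HasDegreeIn-unique {f = f} {g} f≋g (df i) (dg i)

  HasDeg-⊛ : ∀ {k} {f g : Polynomial k} {𝔪 𝔫} → HasDeg f 𝔪 → HasDeg g 𝔫 → HasDeg (f ⊛ g) (zipWith ℕ._+_ 𝔪 𝔫)
  HasDeg-⊛ {f = f} {g} {𝔪} {𝔫} (nf , df) (ng , dg) =
    product-nonzero (bound f) (bound g) (coeff f) (coeff g) (vanish f) (vanish g) nf ng , λ i →
    ≡.subst (HasDegreeIn i (f ⊛ g)) (≡.sym (lookup-zipWith ℕ._+_ i 𝔪 𝔫)) (HasDegreeIn-⊛ {f = f} {g} (df i) (dg i))

  factorDegrees : ∀ {k} {f g h : Polynomial k} {𝔪} → f ⊛ g ≋ h → HasDeg h 𝔪 →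
                  ∃[ 𝔭 ] ∃[ 𝔩 ] (HasDeg f 𝔭 × HasDeg g 𝔩 × zipWith ℕ._+_ 𝔭 𝔩 ≡ 𝔪)
  factorDegrees {f = f} {g} {h} fg≋h dh@((α , h≉0) , _)
    with nonzero? (bound f) (coeff f) (vanish f) | nonzero? (bound g) (coeff g) (vanish g)
  ... | no ¬nf | _      = contradiction
    (trans (sym (fg≋h α)) (∑ᵥ-zero α λ β _ _ → trans (*-congʳ (¬Nonzero ¬nf β)) (zeroˡ _))) h≉0
  ... | yes _  | no ¬ng = contradiction
    (trans (sym (fg≋h α)) (∑ᵥ-zero α λ _ γ _ → trans (*-congˡ (¬Nonzero ¬ng γ)) (zeroʳ _))) h≉0
  ... | yes nf | yes ng with HasDeg-exists f nf | HasDeg-exists g ng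
  ...   | 𝔭 , df | 𝔩 , dg =
    𝔭 , 𝔩 , df , dg , HasDeg-unique {f = f ⊛ g} {h} fg≋h (HasDeg-⊛ {f = f} {g} {𝔭} {𝔩} df dg) dh

  -- Polynomials with coefficients in 𝔽[y]

  liftCoeff : ∀ {k} → Sequence → Vec ℕ (suc k) → Carrier
  liftCoeff {zero}  h (a ∷ [])    = h a
  liftCoeff {suc k} h (zero ∷ α)  = liftCoeff h α
  liftCoeff {suc k} h (suc _ ∷ α) = 0#

  -- A polynomial in the last variable alone.
  lift : ∀ {k} (h : Sequence) → Bounded h → Polynomial (suc k)
  coeff  (lift h b) = liftCoeff h
  bound  (lift h b) = proj₁ b
  vanish (lift {k} h (N , z)) = go
    where
    go : ∀ {k} (α : Vec ℕ (suc k)) i → N ℕ.< lookup α i → liftCoeff h α ≈ 0#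
    go {zero}  (a ∷ [])    zero    lt = z a (ℕ.<⇒≤ lt)
    go {suc k} (zero ∷ α)  (suc i) lt = go α i lt
    go {suc k} (suc _ ∷ α) i       lt = refl

  -- The coefficient in 𝔽[y] of the monomial with exponents β in the other variables.
  slice : ∀ {k} → Polynomial (suc k) → Vec ℕ k → Sequence
  slice f β a = coeff f (β ∷ʳ a)

  slice-ext : ∀ {k} {f g : Polynomial (suc k)} → (∀ β → slice f β ≐ slice g β) → f ≋ g
  slice-ext e α with initLast α
  ... | β , a , ≡.refl = e β a

  slice-bounded : ∀ {k} (f : Polynomial (suc k)) β → Bounded (slice f β)
  slice-bounded {k} f β = suc (bound f) , λ n lt →
    vanish f (β ∷ʳ n) (fromℕ k) (≡.subst (bound f ℕ.<_) (≡.sym (lookup-∷ʳ-fromℕ β n)) lt)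

  -- A factor in 𝔽[y] has exponent 0 in every other variable, so each of those convolutions
  -- collapses to one term. Bare functions in place of polynomials let the induction fix the first
  -- exponent.
  lift-∗ : ∀ {k} h (f : Vec ℕ (suc k) → Carrier) β →
           (λ a → ∑ᵥ (β ∷ʳ a) (λ β γ → liftCoeff h β * f γ)) ≐ h ∗ (λ a → f (β ∷ʳ a))
  lift-∗ h f []      a = refl
  lift-∗ h f (b ∷ β) a = trans (∑ₙ-single 0 b vanishing) (lift-∗ h (f ∘ (b ∷_)) β a)
    where
    vanishing : ∀ b′ c → b′ ℕ.+ c ≡ b → b′ ≢ 0 →
                ∑ᵥ (β ∷ʳ a) (λ β γ → liftCoeff h (b′ ∷ β) * f (c ∷ γ)) ≈ 0#
    vanishing zero    _ _ ne = contradiction ≡.refl ne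
    vanishing (suc _) _ _ _  = ∑ᵥ-zero (β ∷ʳ a) λ _ _ _ → zeroˡ _

  slice-lift-⊛ : ∀ {k} {h} (b : Bounded h) (f : Polynomial (suc k)) β → slice (lift h b ⊛ f) β ≐ h ∗ slice f β
  slice-lift-⊛ {h = h} b f β = lift-∗ h (coeff f) β

  liftCoeff-axis : ∀ {k} h a → liftCoeff h (replicate k 0 ∷ʳ a) ≈ h a
  liftCoeff-axis {zero}  h a = refl
  liftCoeff-axis {suc k} h a = liftCoeff-axis {k} h a

  liftCoeff-nonzero : ∀ {k} h (α : Vec ℕ (suc k)) → ¬ liftCoeff h α ≈ 0# → ∃[ a ] (α ≡ replicate k 0 ∷ʳ a)
  liftCoeff-nonzero {zero}  h (a ∷ [])    nz = a , ≡.refl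
  liftCoeff-nonzero {suc k} h (zero ∷ α)  nz with liftCoeff-nonzero h α nz
  ... | a , eq = a , ≡.cong (0 ∷_) eq
  liftCoeff-nonzero {suc k} h (suc _ ∷ α) nz = contradiction refl nz

  HasDeg-lift : ∀ {k h d} (b : Bounded h) → Degree h d → HasDeg (lift {k} h b) (replicate k 0 ∷ʳ d)
  HasDeg-lift {k} {h} {d} b (h≉0 , z) = (_ , nz) , λ i → (_ , nz , ≡.refl) , le i
    where
    nz : ¬ liftCoeff h (replicate k 0 ∷ʳ d) ≈ 0#
    nz e = h≉0 (trans (sym (liftCoeff-axis {k} h d)) e)
    le : ∀ i α → ¬ liftCoeff h α ≈ 0# → lookup α i ℕ.≤ lookup (replicate k 0 ∷ʳ d) i
    le i α nz with liftCoeff-nonzero h α nz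
    ... | a , ≡.refl = ∷ʳ-mono (replicate k 0) (ℕ.≮⇒≥ λ d<a → nz (trans (liftCoeff-axis {k} h a) (z a d<a))) i

  liftCoeff-slice : ∀ {k} (f : Vec ℕ (suc k) → Carrier) → (∀ β a j → 0 ℕ.< lookup β j → f (β ∷ʳ a) ≈ 0#) →
                    ∀ β a → f (β ∷ʳ a) ≈ liftCoeff (λ a → f (replicate k 0 ∷ʳ a)) (β ∷ʳ a)
  liftCoeff-slice f z []          a = refl
  liftCoeff-slice f z (zero ∷ β)  a = liftCoeff-slice (f ∘ (0 ∷_)) (λ β a j → z (0 ∷ β) a (suc j)) β a
  liftCoeff-slice f z (suc b ∷ β) a = z (suc b ∷ β) a zero (s≤s z≤n)

  slice-degree : ∀ {k} {f : Polynomial (suc k)} {𝔪} → HasDeg f 𝔪 → (∀ j → lookup 𝔪 (inject₁ j) ≡ 0) →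
                 f ≋ lift (slice f (replicate k 0)) (slice-bounded f _)
  slice-degree {k} {f} {𝔪} (_ , df) zs α with initLast α
  ... | β , a , ≡.refl = liftCoeff-slice (coeff f) (λ β a j lt → vanish-above f (df (inject₁ j)) (β ∷ʳ a)
      (≡.subst₂ ℕ._<_ (≡.sym (zs j)) (≡.sym (lookup-∷ʳ-inject₁ β a j)) lt)) β a

  const∣𝟙 : ∀ {k} {e : Polynomial (suc k)} {𝔩} → HasDeg e 𝔩 → (∀ i → lookup 𝔩 i ≡ 0) → e ∣ 𝟙
  const∣𝟙 {k} {e} {𝔩} ((α , e≉0) , de) zs =
    record { quotient = lift (monomial 0 v) bv ; equality = slice-ext {f = lift (monomial 0 v) bv ⊛ e} {𝟙} eq }
    where
    origin : ∀ α → ¬ coeff e α ≈ 0# → α ≡ replicate (suc k) 0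
    origin α nz = lookup-ext λ i → ≡.trans (ℕ.n≤0⇒n≡0 (≡.subst (lookup α i ℕ.≤_) (zs i) (proj₂ (de i) α nz)))
                                           (≡.sym (lookup-replicate i 0))
    e₀≉0 : ¬ coeff e (replicate (suc k) 0) ≈ 0#
    e₀≉0 = ≡.subst (λ α → ¬ coeff e α ≈ 0#) (origin α e≉0) e≉0
    v : Carrier
    v = proj₁ (reciprocal e₀≉0)
    ve≈1 : v * coeff e (replicate (suc k) 0) ≈ 1#
    ve≈1 = proj₂ (reciprocal e₀≉0)
    dv : Degree (monomial 0 v) 0
    dv = unit-nonzero (trans (*-comm _ _) ve≈1) , monomial-vanish 0 v
    bv : Bounded (monomial 0 v)
    bv = Degree⇒Bounded {monomial 0 v} dv
    scaled : ∀ α → v * coeff e α ≈ coeff 𝟙 α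
    scaled α with ≡-dec ℕ._≟_ α (replicate (suc k) 0)
    ... | yes ≡.refl = ve≈1
    ... | no ne      = trans (*-congˡ (decidable-stable (coeff e α ≟ 0#) (ne ∘ origin α))) (zeroʳ v)
    eq : ∀ β → slice (lift (monomial 0 v) bv ⊛ e) β ≐ slice 𝟙 β
    eq β a = trans (slice-lift-⊛ bv e β a) (trans (∗-constˡ (slice e β) dv a) (scaled (β ∷ʳ a)))

  HasDeg-𝟙 : ∀ {k} → HasDeg (𝟙 {k}) (replicate k 0)
  HasDeg-𝟙 {k} = (replicate k 0 , nz) , λ i → (replicate k 0 , nz , ≡.refl) ,
                 λ α nz′ → ℕ.≤-reflexive (≡.cong (λ α → lookup α i) (origin α nz′))
    where
    nz : ¬ coeff 𝟙 (replicate k 0) ≈ 0#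
    nz with ≡-dec ℕ._≟_ (replicate k 0) (replicate k 0)
    ... | yes _ = 1≉0
    ... | no ne = contradiction ≡.refl ne
    origin : ∀ α → ¬ coeff 𝟙 α ≈ 0# → α ≡ replicate k 0
    origin α nz with ≡-dec ℕ._≟_ α (replicate k 0)
    ... | yes eq = eq
    ... | no _   = contradiction refl nz

  lift∤𝟙 : ∀ {k h d} (b : Bounded h) → Degree h (suc d) → ¬ lift {k} h b ∣ 𝟙
  lift∤𝟙 {k} {h} {d} b dh record { quotient = f ; equality = fh≋𝟙 }
    with factorDegrees {f = f} {lift h b} {𝟙} {replicate (suc k) 0} fh≋𝟙 HasDeg-𝟙
  ... | 𝔭 , 𝔩 , _ , dl , eq
    with HasDeg-unique {f = lift {k} h b} {lift h b} {𝔩} {replicate k 0 ∷ʳ suc d} (λ _ → refl) dl (HasDeg-lift b dh)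
  ...   | ≡.refl = contradiction (≡.trans (≡.sym last≡) (lookup-replicate i 0)) (ℕ.m+1+n≢0 (lookup 𝔭 i))
    where
    i : Fin (suc k)
    i = fromℕ k
    last≡ : lookup (replicate (suc k) 0) i ≡ lookup 𝔭 i ℕ.+ suc d
    last≡ = ≡.trans (≡.sym (≡.cong (λ v → lookup v i) eq))
      (≡.trans (lookup-zipWith ℕ._+_ i 𝔭 _) (≡.cong (lookup 𝔭 i ℕ.+_) (lookup-∷ʳ-fromℕ (replicate k 0) (suc d))))

  -- Contents of pairs: existence, uniqueness, degrees

  slices : ∀ {k} → Polynomial (suc k) → Polynomial (suc k) → Family (Vec ℕ k ⊎ Vec ℕ k)
  slices f g = [ slice f , slice g ]

  slices-bounded : ∀ {k} (f g : Polynomial (suc k)) → BoundedFamily (slices f g)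
  slices-bounded f g (inj₁ β) = slice-bounded f β
  slices-bounded f g (inj₂ β) = slice-bounded g β

  -- The content of the pair is the monic gcd of all coefficients of f and g,
  -- regarded as polynomials over 𝔽[y], y being the last variable.
  record Content {k} (f g : Polynomial (suc k)) : Set (c Level.⊔ ℓ₁) where
    field
      degree    : ℕ
      content   : Sequence
      monic     : Monic content degree
      f₀ g₀     : Polynomial (suc k)
      factor    : ∀ i → slices f g i ≐ content ∗ slices f₀ g₀ i
      isPrimitive : Primitive (slices f₀ g₀)

    content-bounded : Bounded content
    content-bounded = Degree⇒Bounded {content} (proj₁ monic)

    factorˡ : lift content content-bounded ⊛ f₀ ≋ f
    factorˡ = slice-ext {f = lift content content-bounded ⊛ f₀} {f}
      λ β → ≐-trans (slice-lift-⊛ content-bounded f₀ β) (≐-sym (factor (inj₁ β)))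

    factorʳ : lift content content-bounded ⊛ g₀ ≋ g
    factorʳ = slice-ext {f = lift content content-bounded ⊛ g₀} {g}
      λ β → ≐-trans (slice-lift-⊛ content-bounded g₀ β) (≐-sym (factor (inj₂ β)))

  ∗-zeroˡ : ∀ {s} t → (∀ n → s n ≈ 0#) → ∀ n → (s ∗ t) n ≈ 0#
  ∗-zeroˡ t z n = ∑ₙ-zero n λ b _ _ → trans (*-congʳ (z b)) (zeroˡ _)

  ∗-zeroʳ : ∀ s {t} → (∀ n → t n ≈ 0#) → ∀ n → (s ∗ t) n ≈ 0#
  ∗-zeroʳ s z n = ∑ₙ-zero n λ _ c _ → trans (*-congˡ (z c)) (zeroʳ _)

  Bounded-scale : ∀ x {s} → Bounded s → Bounded (λ n → x * s n)
  Bounded-scale x (N , z) = N , λ n le → trans (*-congˡ (z n le)) (zeroʳ x)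

  x*[y*z]≈z : ∀ {x y} z → x * y ≈ 1# → x * (y * z) ≈ z
  x*[y*z]≈z z e = trans (sym (*-assoc _ _ _)) (trans (*-congʳ e) (*-identityˡ z))

  makeMonic : ∀ {I : Set} {s d} (t : Family I) → Degree s d → BoundedFamily t →
              ∃[ s′ ] ∃[ t′ ] (Monic s′ d × BoundedFamily t′ × (∀ i → s ∗ t i ≐ s′ ∗ t′ i))
  makeMonic {s = s} {d} t (s≉0 , z) bt with reciprocal s≉0
  ... | v , vs≈1 = (λ n → v * s n) , (λ i n → s d * t i n) ,
    (((λ e → 1≉0 (trans (sym vs≈1) e)) , λ n lt → trans (*-congˡ (z n lt)) (zeroʳ v)) , vs≈1) ,
    (λ i → Bounded-scale (s d) (bt i)) ,
    λ i n → sym (begin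
      ((λ n → v * s n) ∗ (λ n → s d * t i n)) n   ≈⟨ ∗-scaleˡ v s _ n ⟩
      v * (s ∗ (λ n → s d * t i n)) n             ≈⟨ *-congˡ (∗-scaleʳ (s d) s (t i) n) ⟩
      v * (s d * (s ∗ t i) n)                     ≈⟨ x*[y*z]≈z _ vs≈1 ⟩
      (s ∗ t i) n                                 ∎)

  -- The bounds of the cofactors might vary with β; `∗-bound` replaces them by the bound of `f`, as
  -- a polynomial requires.
  fromSlices : ∀ {k s d} (f : Polynomial (suc k)) (T : Vec ℕ k → Sequence) → Degree s d → BoundedFamily T →
               (∀ β → slice f β ≐ s ∗ T β) → ∃[ f′ ] (∀ β → slice {k} f′ β ≐ T β)
  fromSlices {k} {s} f T ds bT eq = f′ , λ β a → reflexive (at β a)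
    where
    at : ∀ β a → T (init (β ∷ʳ a)) (last (β ∷ʳ a)) ≡ T β a
    at β a = ≡.cong₂ T (init-∷ʳ a β) (last-∷ʳ a β)
    vanishing : ∀ α i → bound f ℕ.< lookup α i → T (init α) (last α) ≈ 0#
    vanishing α i lt with initLast α
    -- Raising the last exponent from a to n keeps coordinate i above the bound, whether or not i is
    -- the last variable, so this slice of f vanishes from a on.
    ... | β , a , ≡.refl = ∗-bound ds (bT β) a
      (λ n a≤n → trans (sym (eq β n)) (vanish f (β ∷ʳ n) i (ℕ.<-≤-trans lt (∷ʳ-mono β a≤n i)))) a ℕ.≤-refl
    f′ : Polynomial (suc k)
    f′ = record { coeff = λ α → T (init α) (last α) ; bound = bound f ; vanish = vanishing }

  slice-zero : ∀ {k} {f : Polynomial (suc k)} → (∀ β n → slice f β n ≈ 0#) → ¬ Nonzero (coeff f)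
  slice-zero z (α , nz) with initLast α
  ... | β , a , ≡.refl = nz (z β a)

  HasDegreeIn-lift : ∀ {k h d} (b : Bounded h) → Degree h d → HasDegreeIn (fromℕ k) (lift h b) d
  HasDegreeIn-lift {k} {h} {d} b dh = ≡.subst (HasDegreeIn (fromℕ k) (lift h b))
    (lookup-∷ʳ-fromℕ (replicate k 0) d) (proj₂ (HasDeg-lift b dh) (fromℕ k))

  -- Nonconstant monic common divisors are split off as long as there are any. Each lowers the
  -- degree of f in y, which is the measure, and the excluded middle for `Reducible` is where the
  -- double negation enters.
  content-exists : ∀ N {k d} (f g : Polynomial (suc k)) → d ℕ.< N → HasDegreeIn (fromℕ k) f d → ¬ ¬ Content f g
  content-exists (suc N) {k} {d} f g (s≤s d≤N) df@((α , f≉0 , _) , _) ¬content = ¬¬-excluded-middle λ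
    { (no  none) → ¬content (record
        { degree = 0 ; content = δ ; monic = Degree-δ , refl ; f₀ = f ; g₀ = g
        ; factor = λ i → ≐-sym (∗-identityˡ (slices f g i))
        ; isPrimitive = irreducible⇒primitive none })
    ; (yes (e , s , t , ms , bt , eq)) → step e s t ms bt eq }
    where
    Reducible : Set (c Level.⊔ ℓ₁)
    Reducible = ∃[ e ] ∃[ s ] ∃[ t ] (Monic s (suc e) × BoundedFamily t × (∀ i → slices f g i ≐ s ∗ t i))

    irreducible⇒primitive : ¬ Reducible → Primitive (slices f g)
    irreducible⇒primitive none s t (M , z) bt eq with zero⊎Degree M z
    ... | inj₁ s≐0 =
      contradiction (α , f≉0) (slice-zero {f = f} λ β n → trans (eq (inj₁ β) n) (∗-zeroˡ (t (inj₁ β)) s≐0 n))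
    ... | inj₂ (zero  , _ , ds) = ds
    ... | inj₂ (suc e , _ , ds) with makeMonic t ds bt
    ...   | s′ , t′ , ms′ , bt′ , eq′ = contradiction (e , s′ , t′ , ms′ , bt′ , λ i → ≐-trans (eq i) (eq′ i)) none

    step : ∀ e s t → Monic s (suc e) → BoundedFamily t → (∀ i → slices f g i ≐ s ∗ t i) → _
    step e s t (ds , s≈1) bt eq
      with fromSlices f (t ∘ inj₁) ds (bt ∘ inj₁) (eq ∘ inj₁) | fromSlices g (t ∘ inj₂) ds (bt ∘ inj₂) (eq ∘ inj₂)
    ... | f′ , f′≐ | g′ , g′≐ = content-exists N f′ g′ d′<N (proj₂ f′-degree) λ C →
      let open Content C in ¬content (record
      { degree = suc e ℕ.+ degree ; content = s ∗ content
      ; monic = Degree-∗ ds (proj₁ monic) ,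
                trans (∗-leading (proj₂ ds) (proj₂ (proj₁ monic))) (trans (*-cong s≈1 (proj₂ monic)) (*-identityˡ 1#))
      ; f₀ = f₀ ; g₀ = g₀
      ; factor = λ i n → begin
          slices f g i n                          ≈⟨ eq i n ⟩
          (s ∗ t i) n                             ≈⟨ ∗-cong {s} (λ _ → refl) (≐-trans (≐-sym (t≐ i)) (factor i)) n ⟩
          (s ∗ (content ∗ slices f₀ g₀ i)) n      ≈⟨ ∗-assoc s content (slices f₀ g₀ i) n ⟨
          ((s ∗ content) ∗ slices f₀ g₀ i) n      ∎
      ; isPrimitive = isPrimitive })
      where
      t≐ : ∀ i → slices f′ g′ i ≐ t i
      t≐ (inj₁ β) = f′≐ β
      t≐ (inj₂ β) = g′≐ β
      bs : Bounded s
      bs = Degree⇒Bounded {s} ds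
      f≋ : lift s bs ⊛ f′ ≋ f
      f≋ = slice-ext {f = lift s bs ⊛ f′} {f} λ β → ≐-trans (slice-lift-⊛ bs f′ β)
        (≐-trans (∗-cong {s} (λ _ → refl) (f′≐ β)) (≐-sym (eq (inj₁ β))))
      f′-nonzero : Nonzero (coeff f′)
      f′-nonzero with nonzero? (bound f′) (coeff f′) (vanish f′)
      ... | yes nz = nz
      ... | no ¬nz = contradiction (α , f≉0) (slice-zero {f = f} λ β n → trans (eq (inj₁ β) n)
        (∗-zeroʳ s (λ n → trans (sym (f′≐ β n)) (¬Nonzero ¬nz (β ∷ʳ n))) n))
      f′-degree : ∃[ d′ ] HasDegreeIn (fromℕ k) f′ d′
      f′-degree = HasDegreeIn-exists (fromℕ k) f′ f′-nonzero
      d′<N : proj₁ f′-degree ℕ.< N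
      d′<N = ℕ.<-≤-trans (s≤s (ℕ.m≤n+m _ e)) (≡.subst (ℕ._≤ N)
        (HasDegreeIn-unique {f = f} {lift s bs ⊛ f′} (λ α → sym (f≋ α)) df
          (HasDegreeIn-⊛ {f = lift s bs} {f′} (HasDegreeIn-lift bs ds) (proj₂ f′-degree))) d≤N)

  -- The unit depends on the index because the two polynomials of a pair are normalized
  -- independently.
  Primitive-scale : ∀ {I : Set} {f : Family I} (w w′ : I → Carrier) → (∀ i → w′ i * w i ≈ 1#) →
                    Primitive f → Primitive (λ i n → w i * f i n)
  Primitive-scale {f = f} w w′ w′w≈1 pf s t bs bt eq = pf s (λ i n → w′ i * t i n) bs
    (λ i → Bounded-scale (w′ i) (bt i)) λ i n → begin
      f i n                       ≈⟨ x*[y*z]≈z _ (w′w≈1 i) ⟨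
      w′ i * (w i * f i n)        ≈⟨ *-congˡ (eq i n) ⟩
      w′ i * (s ∗ t i) n          ≈⟨ ∗-scaleʳ (w′ i) s (t i) n ⟨
      (s ∗ (λ n → w′ i * t i n)) n ∎

  -- The two units are absorbed into the second family, which stays primitive; what remains is an
  -- exact equation to which `content-unique` applies.
  content-unique-∼ : ∀ {k h h′ d d′} {f₀ g₀ f₀′ g₀′ : Polynomial (suc k)} (b : Bounded h) (b′ : Bounded h′) →
    Monic h d → Monic h′ d′ → Primitive (slices f₀ g₀) → Primitive (slices f₀′ g₀′) →
    lift h b ⊛ f₀ ∼ lift h′ b′ ⊛ f₀′ → lift h b ⊛ g₀ ∼ lift h′ b′ ⊛ g₀′ →
    h ≐ h′ × f₀ ∼ f₀′ × g₀ ∼ g₀′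
  content-unique-∼ {k} {h} {h′} {f₀ = f₀} {g₀} {f₀′} {g₀′} b b′ mh mh′ p p′
                   (u , iu@(u′ , u′u≈1 , _) , equ) (v , iv@(v′ , v′v≈1 , _) , eqv) =
    proj₁ (proj₂ unique) ,
    (u , iu , fromSlice u f₀ f₀′ (proj₂ (proj₂ unique) ∘ inj₁)) ,
    (v , iv , fromSlice v g₀ g₀′ (proj₂ (proj₂ unique) ∘ inj₂))
    where
    w : Vec ℕ k ⊎ Vec ℕ k → Carrier
    w = [ (λ _ → u) , (λ _ → v) ]
    scaled : Family (Vec ℕ k ⊎ Vec ℕ k)
    scaled i n = w i * slices f₀′ g₀′ i n
    eq : ∀ i → h ∗ slices f₀ g₀ i ≐ h′ ∗ scaled i
    eq (inj₁ β) n = trans (sym (slice-lift-⊛ b f₀ β n)) (trans (equ (β ∷ʳ n))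
      (trans (*-congˡ (slice-lift-⊛ b′ f₀′ β n)) (sym (∗-scaleʳ u h′ (slice f₀′ β) n))))
    eq (inj₂ β) n = trans (sym (slice-lift-⊛ b g₀ β n)) (trans (eqv (β ∷ʳ n))
      (trans (*-congˡ (slice-lift-⊛ b′ g₀′ β n)) (sym (∗-scaleʳ v h′ (slice g₀′ β) n))))
    unique : _ ≡ _ × h ≐ h′ × (∀ i → slices f₀ g₀ i ≐ scaled i)
    unique = content-unique {f = slices f₀ g₀} {scaled} mh mh′ (slices-bounded f₀ g₀)
      (λ i → Bounded-scale (w i) (slices-bounded f₀′ g₀′ i)) p
      (Primitive-scale {f = slices f₀′ g₀′} w [ (λ _ → u′) , (λ _ → v′) ] [ (λ _ → u′u≈1) , (λ _ → v′v≈1) ] p′) eq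
    fromSlice : ∀ u (f g : Polynomial (suc k)) →
                (∀ β n → slice f β n ≈ u * slice g β n) → ∀ α → coeff f α ≈ u * coeff g α
    fromSlice u f g e α with initLast α
    ... | β , a , ≡.refl = e β a

  lift-⊛-∼ : ∀ {k h h′} {f f′ : Polynomial (suc k)} (b : Bounded h) (b′ : Bounded h′) →
             h ≐ h′ → f ∼ f′ → lift h b ⊛ f ∼ lift h′ b′ ⊛ f′
  lift-⊛-∼ {k} {h} {h′} {f} {f′} b b′ h≐h′ (u , iu , eq) = u , iu , go
    where
    go : ∀ α → coeff (lift h b ⊛ f) α ≈ u * coeff (lift h′ b′ ⊛ f′) α
    go α with initLast α
    ... | β , a , ≡.refl = begin
      slice (lift h b ⊛ f) β a             ≈⟨ slice-lift-⊛ b f β a ⟩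
      (h ∗ slice f β) a                    ≈⟨ ∗-cong h≐h′ (λ n → eq (β ∷ʳ n)) a ⟩
      (h′ ∗ (λ n → u * slice f′ β n)) a    ≈⟨ ∗-scaleʳ u h′ (slice f′ β) a ⟩
      u * (h′ ∗ slice f′ β) a              ≈⟨ *-congˡ (slice-lift-⊛ b′ f′ β a) ⟨
      u * slice (lift h′ b′ ⊛ f′) β a      ∎

  ∼-via : ∀ {k} {f f′ g g′ : Polynomial k} → f ≋ g → f ∼ f′ → f′ ≋ g′ → g ∼ g′
  ∼-via f≋g (u , iu , e) f′≋g′ = u , iu , λ α → trans (sym (f≋g α)) (trans (e α) (*-congˡ (f′≋g′ α)))

  Content-∼ : ∀ {k} {f g f′ g′ : Polynomial (suc k)} (C : Content f g) (C′ : Content f′ g′) →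
              Content.content C ≐ Content.content C′ → Content.f₀ C ∼ Content.f₀ C′ → Content.g₀ C ∼ Content.g₀ C′ →
              f ∼ f′ × g ∼ g′
  Content-∼ {f = f} {g} {f′} {g′} C C′ same f∼ g∼ =
    ∼-via {f = lift C.content C.content-bounded ⊛ C.f₀} {lift C′.content C′.content-bounded ⊛ C′.f₀} {f} {f′} C.factorˡ
      (lift-⊛-∼ {f = C.f₀} {C′.f₀} C.content-bounded C′.content-bounded same f∼) C′.factorˡ ,
    ∼-via {f = lift C.content C.content-bounded ⊛ C.g₀} {lift C′.content C′.content-bounded ⊛ C′.g₀} {g} {g′} C.factorʳ
      (lift-⊛-∼ {f = C.g₀} {C′.g₀} C.content-bounded C′.content-bounded same g∼) C′.factorʳ
    where
    module C = Content C
    module C′ = Content C′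

  HasDeg-lift-⊛ : ∀ {k h d} {f g : Polynomial (suc k)} {𝔪} (b : Bounded h) → Degree h d →
                  lift h b ⊛ f ≋ g → HasDeg g 𝔪 →
                  ∃[ μ ] ∃[ e ] (HasDeg f (μ ∷ʳ e) × 𝔪 ≡ μ ∷ʳ (d ℕ.+ e))
  HasDeg-lift-⊛ {k} {h} {d} {f} {g} {𝔪} b dh eq dg with factorDegrees {f = lift h b} {f} {g} {𝔪} eq dg
  ... | 𝔭 , 𝔩 , dp , dl , ≡.refl with initLast 𝔩
  ...   | μ , e , ≡.refl
    with HasDeg-unique {f = lift h b} {lift h b} {𝔭} {replicate k 0 ∷ʳ d} (λ _ → refl) dp (HasDeg-lift b dh)
  ...     | ≡.refl = μ , e , dl , axis-+ d μ e

  HasDeg-lower : ∀ {k h h′ d} {f g : Polynomial (suc k)} {𝔪} (b : Bounded h) (b′ : Bounded h′) →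
                 Degree h (suc d) → Degree h′ d → lift h b ⊛ f ≋ g → HasDeg g 𝔪 →
                 HasDeg (lift h′ b′ ⊛ f) (lowerLast 𝔪)
  HasDeg-lower {k} {h} {h′} {d} {f} {g} {𝔪} b b′ dh dh′ eq dg with HasDeg-lift-⊛ {f = f} {g} {𝔪} b dh eq dg
  ... | μ , e , df , ≡.refl = ≡.subst (HasDeg (lift h′ b′ ⊛ f))
    (≡.trans (axis-+ d μ e) (≡.sym (lowerLast-∷ʳ μ _)))
    (HasDeg-⊛ {f = lift h′ b′} {f} {replicate k 0 ∷ʳ _} {μ ∷ʳ e} (HasDeg-lift b′ dh′) df)

  HasDeg-raise : ∀ {k h h′ d} {f g : Polynomial (suc k)} {𝔪} (b : Bounded h) (b′ : Bounded h′) →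
                 0 ℕ.< lookup 𝔪 (fromℕ k) →
                 Degree h d → Degree h′ (suc d) → lift h b ⊛ f ≋ g → HasDeg g (lowerLast 𝔪) →
                 HasDeg (lift h′ b′ ⊛ f) 𝔪
  HasDeg-raise {k} {h} {h′} {d} {f} {g} {𝔪} b b′ pos dh dh′ eq dg
    with HasDeg-lift-⊛ {f = f} {g} {lowerLast 𝔪} b dh eq dg | initLast 𝔪
  ... | μ , e , df , lower≡ | ν , x , ≡.refl
    -- `pos` excludes x = 0, where the truncated predecessor would leave the degree as it is.
    with x | ≡.subst (0 ℕ.<_) (lookup-∷ʳ-fromℕ ν x) pos | ∷ʳ-injective ν μ (≡.trans (≡.sym (lowerLast-∷ʳ ν x)) lower≡)
  ...   | suc y | _ | ≡.refl , ≡.refl = ≡.subst (HasDeg (lift h′ b′ ⊛ f)) (axis-+ (suc d) μ e)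
    (HasDeg-⊛ {f = lift h′ b′} {f} {replicate k 0 ∷ʳ _} {μ ∷ʳ e} (HasDeg-lift b′ dh′) df)

  -- Classification of pairs and encoding of shared factors

  open Words (toFin 0#) (toFin 1#) (λ e → 1≉0 (sym (to-injective setoid card e)))

  ≋⇒∼ : ∀ {k} {f g : Polynomial k} → f ≋ g → f ∼ g
  ≋⇒∼ e = 1# , (1# , *-identityˡ 1# , *-identityˡ 1#) , λ α → trans (e α) (sym (*-identityˡ _))

  slice-𝟙 : ∀ {k} → Degree (slice 𝟙 (replicate k 0)) 0 × slice 𝟙 (replicate k 0) 0 ≈ 1#
  slice-𝟙 {k} = ((λ z → 1≉0 (trans (sym at-0) z)) , λ n lt →
      vanish-above 𝟙 (proj₂ HasDeg-𝟙 (fromℕ k)) (replicate k 0 ∷ʳ n)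
        (≡.subst₂ ℕ._<_ (≡.sym (lookup-replicate (fromℕ k) 0)) (≡.sym (lookup-∷ʳ-fromℕ (replicate k 0) n)) lt)) , at-0
    where
    at-0 : slice 𝟙 (replicate k 0) 0 ≈ 1#
    at-0 with ≡-dec ℕ._≟_ (replicate k 0 ∷ʳ 0) (replicate (suc k) 0)
    ... | yes _ = refl
    ... | no ne = contradiction (replicate-∷ʳ-0 k) ne

  𝟙∣ : ∀ {k} (f : Polynomial (suc k)) → 𝟙 ∣ f
  𝟙∣ {k} f = record { quotient = f ; equality = λ α → trans (⊛-comm f 𝟙 α) (𝟙⊛ α) }
    where
    o : Sequence
    o = slice 𝟙 (replicate k 0)
    bo : Bounded o
    bo = slice-bounded 𝟙 (replicate k 0)
    𝟙≋ : 𝟙 ≋ lift o bo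
    𝟙≋ = slice-degree {f = 𝟙} {replicate (suc k) 0} HasDeg-𝟙 (λ j → lookup-replicate (inject₁ j) 0)
    𝟙⊛ : 𝟙 ⊛ f ≋ f
    𝟙⊛ = slice-ext {f = 𝟙 ⊛ f} {f} λ β n → begin
      slice (𝟙 ⊛ f) β n          ≈⟨ ⊛-cong {f = 𝟙} {lift o bo} {f} {f} 𝟙≋ (λ _ → refl) (β ∷ʳ n) ⟩
      slice (lift o bo ⊛ f) β n  ≈⟨ slice-lift-⊛ bo f β n ⟩
      (o ∗ slice f β) n          ≈⟨ ∗-constˡ (slice f β) (proj₁ (slice-𝟙 {k})) n ⟩
      o 0 * slice f β n          ≈⟨ *-congʳ (proj₂ (slice-𝟙 {k})) ⟩
      1# * slice f β n           ≈⟨ *-identityˡ _ ⟩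
      slice f β n                ∎

  record Shared {k} (f g : Polynomial (suc k)) (𝔪 𝔫 : Vec ℕ (suc k)) : Set (c Level.⊔ ℓ₁) where
    field
      e p r    : Polynomial (suc k)
      𝔩 𝔭 𝔯    : Vec ℕ (suc k)
      degₑ     : HasDeg e 𝔩
      degₚ     : HasDeg p 𝔭
      degᵣ     : HasDeg r 𝔯
      factorˡ  : p ⊛ e ≋ f
      factorʳ  : r ⊛ e ≋ g
      sumˡ     : zipWith ℕ._+_ 𝔭 𝔩 ≡ 𝔪
      sumʳ     : zipWith ℕ._+_ 𝔯 𝔩 ≡ 𝔫
      j        : Fin k
      positive : 0 ℕ.< lookup 𝔩 (inject₁ j)

  -- `shared` and `content⁺` may overlap. For an upper bound it suffices that every pair is of some
  -- kind.
  data Kind {k} (f g : Polynomial (suc k)) (𝔪 𝔫 : Vec ℕ (suc k)) : Set (c Level.⊔ ℓ₁) where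
    coprime  : Coprime f g → Kind f g 𝔪 𝔫
    shared   : Shared f g 𝔪 𝔫 → Kind f g 𝔪 𝔫
    content⁺ : (C : Content f g) → ∀ d → Content.degree C ≡ suc d → Kind f g 𝔪 𝔫

  -- A monic content of degree 0 is 1, so f and g have the same slices as the primitive cofactors.
  content-0 : ∀ {k} {f g : Polynomial (suc k)} (C : Content f g) → Content.degree C ≡ 0 → Primitive (slices f g)
  content-0 {f = f} {g} C eq s t bs bt f≐ = isPrimitive s t bs bt λ i n → begin
      slices f₀ g₀ i n                ≈⟨ *-identityˡ _ ⟨
      1# * slices f₀ g₀ i n           ≈⟨ *-congʳ (≡.subst (λ d → content d ≈ 1#) eq (proj₂ monic)) ⟨
      content 0 * slices f₀ g₀ i n    ≈⟨ ∗-constˡ (slices f₀ g₀ i) (≡.subst (Degree content) eq (proj₁ monic)) n ⟨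
      (content ∗ slices f₀ g₀ i) n    ≈⟨ factor i n ⟨
      slices f g i n                  ≈⟨ f≐ i n ⟩
      (s ∗ t i) n                     ∎
    where open Content C

  -- A common divisor has degree 0 in all variables but y, for otherwise it would be shared. So it
  -- lies in 𝔽[y] and divides every slice of f and g, and primitivity makes it constant.
  primitive⇒coprime : ∀ {k} {f g : Polynomial (suc k)} {𝔪 𝔫} → HasDeg f 𝔪 → HasDeg g 𝔫 →
                      Primitive (slices f g) → ¬ Shared f g 𝔪 𝔫 → Coprime f g
  primitive⇒coprime {k} {f} {g} {𝔪} {𝔫} df dg pr ¬shared = 𝟙∣ f , 𝟙∣ g , common
    where
    common : ∀ e → e ∣ f → e ∣ g → e ∣ 𝟙
    common e record { quotient = p ; equality = pe≋f } record { quotient = r ; equality = re≋g }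
      with factorDegrees {f = p} {e} {f} {𝔪} pe≋f df | factorDegrees {f = r} {e} {g} {𝔫} re≋g dg
    ... | 𝔭 , 𝔩 , dp , de , eq | 𝔯 , 𝔩′ , dr , de′ , eq′
      with HasDeg-unique {f = e} {e} {𝔩′} {𝔩} (λ _ → refl) de′ de
    ...   | ≡.refl with Fin.any? (λ j → 0 ℕ.<? lookup 𝔩 (inject₁ j))
    ...     | yes (j , pos) = contradiction (record
                { e = e ; p = p ; r = r ; degₑ = de ; degₚ = dp ; degᵣ = dr ; factorˡ = pe≋f ; factorʳ = re≋g
                ; sumˡ = eq ; sumʳ = eq′ ; j = j ; positive = pos }) ¬shared
    ...     | no none = const∣𝟙 {e = e} {𝔩} de zeros
      where
      s : Sequence
      s = slice e (replicate k 0)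
      bs : Bounded s
      bs = slice-bounded e (replicate k 0)
      e≋ : e ≋ lift s bs
      e≋ = slice-degree {f = e} {𝔩} de λ j → ℕ.n≤0⇒n≡0 (ℕ.≮⇒≥ λ lt → none (j , lt))
      through : ∀ {f p} → p ⊛ e ≋ f → ∀ β → slice f β ≐ s ∗ slice p β
      through {f} {p} pe≋f β n = begin
        slice f β n              ≈⟨ pe≋f (β ∷ʳ n) ⟨
        slice (p ⊛ e) β n        ≈⟨ ⊛-comm p e (β ∷ʳ n) ⟩
        slice (e ⊛ p) β n        ≈⟨ ⊛-cong {f = e} {lift s bs} {p} {p} e≋ (λ _ → refl) (β ∷ʳ n) ⟩
        slice (lift s bs ⊛ p) β n ≈⟨ slice-lift-⊛ bs p β n ⟩
        (s ∗ slice p β) n        ∎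
      ds : Degree s 0
      ds = pr s (slices p r) bs (slices-bounded p r)
        λ { (inj₁ β) → through {f} {p} pe≋f β ; (inj₂ β) → through {g} {r} re≋g β }
      zeros : ∀ i → lookup 𝔩 i ≡ 0
      zeros i = ≡.trans (≡.cong (λ v → lookup v i) (≡.trans
        (HasDeg-unique {f = e} {lift s bs} {𝔩} {replicate k 0 ∷ʳ 0} e≋ de (HasDeg-lift bs ds)) (replicate-∷ʳ-0 k)))
        (lookup-replicate i 0)

  classify : ∀ {k} {f g : Polynomial (suc k)} {𝔪 𝔫} → HasDeg f 𝔪 → HasDeg g 𝔫 → ¬ ¬ Kind f g 𝔪 𝔫
  classify {k} {f} {g} {𝔪} {𝔫} df dg ¬kind =
    content-exists _ f g ℕ.≤-refl (proj₂ df (fromℕ k)) λ C → byDegree C (Content.degree C) ≡.refl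
    where
    byDegree : (C : Content f g) → ∀ d → Content.degree C ≡ d → _
    byDegree C (suc d) eq = ¬kind (content⁺ C d eq)
    byDegree C zero    eq = ¬¬-excluded-middle λ
      { (yes s)      → ¬kind (shared s)
      ; (no ¬shared) → ¬kind (coprime (primitive⇒coprime {f = f} {g} {𝔪} {𝔫} df dg (content-0 C eq) ¬shared)) }

  coefficients-determine : ∀ {k} {f g : Polynomial k} {𝔪} → HasDeg f 𝔪 → HasDeg g 𝔪 →
                           (toFin ∘ coeff f) ≗[ 𝔪 ] (toFin ∘ coeff g) → f ≋ g
  coefficients-determine {f = f} {g} {𝔪} df dg same α with Fin.all? (λ i → lookup α i ℕ.≤? lookup 𝔪 i)
  ... | yes le = to-injective setoid card (same α le)
  ... | no ¬le = trans (vanishes f df) (sym (vanishes g dg))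
    where
    vanishes : ∀ f → HasDeg f 𝔪 → coeff f α ≈ 0#
    vanishes f (_ , df) = decidable-stable (coeff f α ≟ 0#) (λ nz → ¬le λ i → proj₂ (df i) α nz)

  -- The unary prefix determines the lengths of the other three blocks, so words of
  -- one common length encode all 𝔩 together; this does the summation over 𝔩.
  module Encode {k} {f g : Polynomial (suc k)} {𝔪 𝔫} (S : Shared f g 𝔪 𝔫)
                (1<max : ∀ j → 1 ℕ.< lookup 𝔪 (inject₁ j) ℕ.⊔ lookup 𝔫 (inject₁ j)) where
    open Shared S

    body : List (Fin q) → List (Fin q)
    body xs = unary 𝔩 (write 𝔩 (toFin ∘ coeff e) (write 𝔭 (toFin ∘ coeff p) (write 𝔯 (toFin ∘ coeff r) xs)))

    room : volume 𝔩 ℕ.+ volume 𝔭 ℕ.+ volume 𝔯 ℕ.+ sum 𝔩 ℕ.≤ errorExponent 𝔪 𝔫 ℕ.+ 3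
    room = ℕ.≤-trans
      (factorizationBound 𝔩 𝔭 𝔯 (inject₁ j) positive
        (≡.subst₂ (λ 𝔪 𝔫 → 1 ℕ.< lookup 𝔪 (inject₁ j) ℕ.⊔ lookup 𝔫 (inject₁ j)) (≡.sym sumˡ) (≡.sym sumʳ) (1<max j)))
      (ℕ.+-monoˡ-≤ 3 (≡.subst₂ (λ 𝔪′ 𝔫′ → weight 𝔪′ (inject₁ j) ℕ.+ weight 𝔫′ (inject₁ j) ℕ.≤ errorExponent 𝔪 𝔫)
        (≡.sym sumˡ) (≡.sym sumʳ) (weight≤errorExponent 𝔪 𝔫 j)))

    padding : List (Fin q)
    -- Any filler works: all preceding blocks are read back from the front.
    padding = List.replicate (proj₁ (ℕ.m≤n⇒∃[o]m+o≡n room)) (toFin 0#)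

    word : List (Fin q)
    word = body padding

    -- The 3 comes from `factorizationBound`, and `suc k` counts the end marks of `unary`, one per
    -- variable.
    length-word : length word ≡ errorExponent 𝔪 𝔫 ℕ.+ 3 ℕ.+ suc k
    length-word = ≡.trans
      (≡.trans (length-unary 𝔩 _) (≡.cong (sum 𝔩 ℕ.+ suc k ℕ.+_) (≡.trans (length-write 𝔩 _ _)
        (≡.cong (volume 𝔩 ℕ.+_) (≡.trans (length-write 𝔭 _ _) (≡.cong (volume 𝔭 ℕ.+_)
        (≡.trans (length-write 𝔯 _ _) (≡.cong (volume 𝔯 ℕ.+_) (List.length-replicate _)))))))))
      (≡.trans (rearrange (sum 𝔩) (suc k) (volume 𝔩) (volume 𝔭) (volume 𝔯) (proj₁ (ℕ.m≤n⇒∃[o]m+o≡n room)))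
        (≡.cong (ℕ._+ suc k) (proj₂ (ℕ.m≤n⇒∃[o]m+o≡n room))))
      where
      rearrange : ∀ s k a b c o → s ℕ.+ k ℕ.+ (a ℕ.+ (b ℕ.+ (c ℕ.+ o))) ≡ a ℕ.+ b ℕ.+ c ℕ.+ s ℕ.+ o ℕ.+ k
      rearrange = solve-∀

    code : Fin (q ℕ.^ (errorExponent 𝔪 𝔫 ℕ.+ 3 ℕ.+ suc k))
    code = index _ word length-word

  -- The prefix yields `𝔩`; subtracting it from the fixed `𝔪` and `𝔫` yields `𝔭` and `𝔯`, after
  -- which the three blocks can be read in turn and multiplied out.
  word-injective : ∀ {k} {f g f′ g′ : Polynomial (suc k)} {𝔪 𝔫} (S : Shared f g 𝔪 𝔫) (S′ : Shared f′ g′ 𝔪 𝔫) b b′ →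
                   Encode.word S b ≡ Encode.word S′ b′ → f ≋ f′ × g ≋ g′
  word-injective S@record { 𝔩 = 𝔩 ; 𝔭 = 𝔭 ; 𝔯 = 𝔯 } S′@record { 𝔩 = 𝔩′ ; 𝔭 = 𝔭′ ; 𝔯 = 𝔯′ } b b′ eq
    with unary-injective 𝔩 𝔩′ eq
  ... | ≡.refl , eq₁
    with zipWith-+-cancelʳ 𝔭 𝔭′ 𝔩 (≡.trans (Shared.sumˡ S) (≡.sym (Shared.sumˡ S′)))
       | zipWith-+-cancelʳ 𝔯 𝔯′ 𝔩 (≡.trans (Shared.sumʳ S) (≡.sym (Shared.sumʳ S′)))
       | write-injective 𝔩 eq₁
  ...   | ≡.refl | ≡.refl | sameₑ , eq₂ with write-injective 𝔭 eq₂
  ...     | sameₚ , eq₃ with write-injective 𝔯 eq₃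
  ...       | sameᵣ , _ =
    (λ α → trans (sym (S.factorˡ α)) (trans (⊛-cong {f = S.p} {S′.p} {S.e} {S′.e} p≋ e≋ α) (S′.factorˡ α))) ,
    (λ α → trans (sym (S.factorʳ α)) (trans (⊛-cong {f = S.r} {S′.r} {S.e} {S′.e} r≋ e≋ α) (S′.factorʳ α)))
    where
    module S = Shared S
    module S′ = Shared S′
    e≋ : S.e ≋ S′.e
    e≋ = coefficients-determine {f = S.e} {S′.e} {𝔩} S.degₑ S′.degₑ sameₑ
    p≋ : S.p ≋ S′.p
    p≋ = coefficients-determine {f = S.p} {S′.p} {𝔭} S.degₚ S′.degₚ sameₚ
    r≋ : S.r ≋ S′.r
    r≋ = coefficients-determine {f = S.r} {S′.r} {𝔯} S.degᵣ S′.degᵣ sameᵣ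

  code-injective : ∀ {k} {f g f′ g′ : Polynomial (suc k)} {𝔪 𝔫} (S : Shared f g 𝔪 𝔫) (S′ : Shared f′ g′ 𝔪 𝔫) b b′ →
                   Encode.code S b ≡ Encode.code S′ b′ → f ≋ f′ × g ≋ g′
  code-injective {k} {𝔪 = 𝔪} {𝔫} S S′ b b′ eq = word-injective S S′ b b′
    (index-injective (errorExponent 𝔪 𝔫 ℕ.+ 3 ℕ.+ suc k) (Encode.word S b) (Encode.word S′ b′)
      {Encode.length-word S b} {Encode.length-word S′ b′} eq)

  -- The two injections

  module Counting {k : ℕ} (𝔪 𝔫 : Vec ℕ (suc k)) {P Nₘ Nₙ Nₘ₋₁ Nₙ₋₁ : ℕ}
                  (cardP : HasCardinality (𝒫 F 𝔪 𝔫) P)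
                  (cardₘ : HasCardinality (𝒩 F 𝔪) Nₘ) (cardₙ : HasCardinality (𝒩 F 𝔫) Nₙ)
                  (cardₘ₋₁ : HasCardinality (𝒩 F (lowerLast 𝔪)) Nₘ₋₁)
                  (cardₙ₋₁ : HasCardinality (𝒩 F (lowerLast 𝔫)) Nₙ₋₁) where

    open Inverse using (to; from)

    f : Fin Nₘ → Polynomial (suc k)
    f i = proj₁ (from cardₘ i)

    g : Fin Nₙ → Polynomial (suc k)
    g j = proj₁ (from cardₙ j)

    f₋ : Fin Nₘ₋₁ → Polynomial (suc k)
    f₋ i = proj₁ (from cardₘ₋₁ i)

    g₋ : Fin Nₙ₋₁ → Polynomial (suc k)
    g₋ j = proj₁ (from cardₙ₋₁ j)

    module Upper (1<max : ∀ j → 1 ℕ.< lookup 𝔪 (inject₁ j) ℕ.⊔ lookup 𝔫 (inject₁ j))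
                 (kind : ∀ i j → Kind (f i) (g j) 𝔪 𝔫) where

      Target : Set
      Target = Fin P ⊎ (Fin (q ℕ.^ (errorExponent 𝔪 𝔫 ℕ.+ 3 ℕ.+ suc k)) ⊎ (Fin q × (Fin Nₘ₋₁ × Fin Nₙ₋₁)))

      module Tail {f g : Polynomial (suc k)} (C : Content f g) {d} (eq : Content.degree C ≡ suc d) where
        open Content C

        -- This is h′ in h = a + y h′. The coefficient a is recorded separately, whence the factor
        -- q.
        tail : Sequence
        tail = content ∘ suc

        tail-monic : Monic tail d
        tail-monic with ≡.subst (Monic content) eq monic
        ... | (nz , z) , m = (nz , λ n lt → z (suc n) (s≤s lt)) , m

        tail-bounded : Bounded tail
        tail-bounded = Degree⇒Bounded {tail} (proj₁ tail-monic)

        content-degree : Degree content (suc d)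
        content-degree = ≡.subst (Degree content) eq (proj₁ monic)

        lowerˡ : HasDeg f 𝔪 → Setoid.Carrier (𝒩 F (lowerLast 𝔪))
        lowerˡ df = lift tail tail-bounded ⊛ f₀ ,
          HasDeg-lower {f = f₀} {f} {𝔪} content-bounded tail-bounded content-degree (proj₁ tail-monic) factorˡ df

        lowerʳ : HasDeg g 𝔫 → Setoid.Carrier (𝒩 F (lowerLast 𝔫))
        lowerʳ dg = lift tail tail-bounded ⊛ g₀ ,
          HasDeg-lower {f = g₀} {g} {𝔫} content-bounded tail-bounded content-degree (proj₁ tail-monic) factorʳ dg

      encode : ∀ i j → Kind (f i) (g j) 𝔪 𝔫 → Target
      encode i j (coprime cop)     = inj₁ (to cardP ((from cardₘ i , from cardₙ j) , cop))
      encode i j (shared S)        = inj₂ (inj₁ (Encode.code S 1<max))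
      encode i j (content⁺ C d eq) = inj₂ (inj₂ (toFin (Content.content C 0) ,
        to cardₘ₋₁ (Tail.lowerˡ C eq (proj₂ (from cardₘ i))) ,
        to cardₙ₋₁ (Tail.lowerʳ C eq (proj₂ (from cardₙ j)))))

      -- The tails are monic and the cofactors primitive, so uniqueness of contents recovers both
      -- from the lowered pair; the coefficient at 0 completes the content.
      content-injective : ∀ {f g f′ g′ : Polynomial (suc k)} (C : Content f g) (C′ : Content f′ g′) {d d′}
        (eq : Content.degree C ≡ suc d) (eq′ : Content.degree C′ ≡ suc d′) →
        (let module T = Tail C eq) (let module T′ = Tail C′ eq′) →
        Content.content C 0 ≈ Content.content C′ 0 →
        lift T.tail T.tail-bounded ⊛ Content.f₀ C ∼ lift T′.tail T′.tail-bounded ⊛ Content.f₀ C′ →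
        lift T.tail T.tail-bounded ⊛ Content.g₀ C ∼ lift T′.tail T′.tail-bounded ⊛ Content.g₀ C′ →
        f ∼ f′ × g ∼ g′
      content-injective {f} {g} {f′} {g′} C C′ eq eq′ e₀ ef eg =
        Content-∼ {f = f} {g} {f′} {g′} C C′ same (proj₁ (proj₂ unique)) (proj₂ (proj₂ unique))
        where
        module C = Content C
        module C′ = Content C′
        module T = Tail C eq
        module T′ = Tail C′ eq′
        unique = content-unique-∼ {f₀ = C.f₀} {C.g₀} {C′.f₀} {C′.g₀} T.tail-bounded T′.tail-bounded
                   T.tail-monic T′.tail-monic C.isPrimitive C′.isPrimitive ef eg
        same : C.content ≐ C′.content
        same zero    = e₀
        same (suc n) = proj₁ unique n

      -- Different kinds land in different summands of `Target`, so only like kinds have to be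
      -- compared.
      encode-injective : ∀ i j i′ j′ K K′ → encode i j K ≡ encode i′ j′ K′ → f i ∼ f i′ × g j ∼ g j′
      encode-injective i j i′ j′ (coprime _) (coprime _) eq = to-injective (𝒫 F 𝔪 𝔫) cardP (inj₁-injective eq)
      encode-injective i j i′ j′ (shared S) (shared S′) eq =
        Product.map (≋⇒∼ {f = f i} {f i′}) (≋⇒∼ {f = g j} {g j′})
          (code-injective S S′ 1<max 1<max (inj₁-injective (inj₂-injective eq)))
      encode-injective i j i′ j′ (content⁺ C d e) (content⁺ C′ d′ e′) eq =
        content-injective C C′ e e′ (to-injective setoid card (proj₁ parts))
          (to-injective (𝒩 F (lowerLast 𝔪)) cardₘ₋₁ (proj₁ (proj₂ parts)))
          (to-injective (𝒩 F (lowerLast 𝔫)) cardₙ₋₁ (proj₂ (proj₂ parts)))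
        where
        triple = inj₂-injective (inj₂-injective eq)
        parts = ,-injectiveˡ triple , ,-injectiveˡ (,-injectiveʳ triple) , ,-injectiveʳ (,-injectiveʳ triple)

      bound-above : Nₘ ℕ.* Nₙ ℕ.≤ P ℕ.+ (q ℕ.^ (errorExponent 𝔪 𝔫 ℕ.+ 3 ℕ.+ suc k) ℕ.+ q ℕ.* (Nₘ₋₁ ℕ.* Nₙ₋₁))
      bound-above = injection⇒≤ Fin.*↔×
        ((↔-id _ ⊎-↔ ((↔-id _ ⊎-↔ ((↔-id _ ×-↔ Fin.*↔×) ↔-∘ Fin.*↔×)) ↔-∘ Fin.+↔⊎)) ↔-∘ Fin.+↔⊎)
        (λ (i , j) → encode i j (kind i j))
        λ (i , j) (i′ , j′) eq → let f∼ , g∼ = encode-injective i j i′ j′ (kind i j) (kind i′ j′) eq in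
          ≡.cong₂ _,_ (from-injective (𝒩 F 𝔪) cardₘ f∼) (from-injective (𝒩 F 𝔫) cardₙ g∼)

    module Lower (0<m : 0 ℕ.< lookup 𝔪 (fromℕ k)) (0<n : 0 ℕ.< lookup 𝔫 (fromℕ k))
                 (contents : ∀ i j → Content (f₋ i) (g₋ j)) where

      cons : Carrier → Sequence → Sequence
      cons a s zero    = a
      cons a s (suc n) = s n

      Monic-cons : ∀ {a s d} → Monic s d → Monic (cons a s) (suc d)
      Monic-cons ((nz , z) , m) = (nz , λ { (suc n) (s≤s lt) → z n lt }) , m

      module Raise (a : Fin q) (i : Fin Nₘ₋₁) (j : Fin Nₙ₋₁) where
        open Content (contents i j) public

        raised : Sequence
        raised = cons (fromFin a) content

        raised-monic : Monic raised (suc degree)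
        raised-monic = Monic-cons monic

        raised-bounded : Bounded raised
        raised-bounded = Degree⇒Bounded {raised} (proj₁ raised-monic)

        raiseˡ : Setoid.Carrier (𝒩 F 𝔪)
        raiseˡ = lift raised raised-bounded ⊛ f₀ , HasDeg-raise {f = f₀} {f₋ i} {𝔪} content-bounded raised-bounded 0<m
          (proj₁ monic) (proj₁ raised-monic) factorˡ (proj₂ (from cardₘ₋₁ i))

        raiseʳ : Setoid.Carrier (𝒩 F 𝔫)
        raiseʳ = lift raised raised-bounded ⊛ g₀ , HasDeg-raise {f = g₀} {g₋ j} {𝔫} content-bounded raised-bounded 0<n
          (proj₁ monic) (proj₁ raised-monic) factorʳ (proj₂ (from cardₙ₋₁ j))

      pair : Fin P ⊎ (Fin q × (Fin Nₘ₋₁ × Fin Nₙ₋₁)) → Setoid.Carrier (𝒩 F 𝔪) × Setoid.Carrier (𝒩 F 𝔫)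
      pair (inj₁ x)           = proj₁ (from cardP x)
      pair (inj₂ (a , i , j)) = Raise.raiseˡ a i j , Raise.raiseʳ a i j

      scale : Carrier → Polynomial (suc k) → Polynomial (suc k)
      scale u f = record { coeff = λ α → u * coeff f α ; bound = bound f
                         ; vanish = λ α i lt → trans (*-congˡ (vanish f α i lt)) (zeroʳ u) }

      -- Divisibility is up to `_≋_`, while representatives are known only up to `_∼_`; the unit is
      -- moved into the cofactor.
      lift∣ : ∀ {h} (b : Bounded h) {f f₀ : Polynomial (suc k)} → f ∼ lift h b ⊛ f₀ → lift h b ∣ f
      lift∣ {h} b {f} {f₀} (u , _ , e) = record { quotient = scale u f₀ ; equality = λ α →
        trans (⊛-comm (scale u f₀) (lift h b) α) (slice-ext {f = lift h b ⊛ scale u f₀} {f} eq α) }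
        where
        eq : ∀ β → slice (lift h b ⊛ scale u f₀) β ≐ slice f β
        eq β n = trans (slice-lift-⊛ b (scale u f₀) β n) (trans (∗-scaleʳ u h (slice f₀ β) n)
          (trans (*-congˡ (sym (slice-lift-⊛ b f₀ β n))) (sym (e (β ∷ʳ n)))))

      -- The raised content has degree at least 1 in y and would divide both members of a coprime
      -- pair, hence 𝟙.
      coprime≢raised : ∀ x a i j → proj₁ (proj₁ (proj₁ (from cardP x))) ∼ proj₁ (Raise.raiseˡ a i j) →
                       ¬ proj₁ (proj₂ (proj₁ (from cardP x))) ∼ proj₁ (Raise.raiseʳ a i j)
      coprime≢raised x a i j f∼ g∼ = lift∤𝟙 raised-bounded (proj₁ raised-monic)
        (proj₂ (proj₂ (proj₂ (from cardP x))) (lift raised raised-bounded)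
          (lift∣ raised-bounded {_} {f₀} f∼) (lift∣ raised-bounded {_} {g₀} g∼))
        where open Raise a i j

      -- Uniqueness applied to the raised contents returns a at index 0 and the original content at
      -- the later ones.
      raise-injective : ∀ a i j a′ i′ j′ →
        proj₁ (Raise.raiseˡ a i j) ∼ proj₁ (Raise.raiseˡ a′ i′ j′) →
        proj₁ (Raise.raiseʳ a i j) ∼ proj₁ (Raise.raiseʳ a′ i′ j′) →
        (a , i , j) ≡ (a′ , i′ , j′)
      raise-injective a i j a′ i′ j′ f∼ g∼ = ≡.cong₂ _,_ (from-injective setoid card (proj₁ unique 0)) (≡.cong₂ _,_
        (from-injective (𝒩 F (lowerLast 𝔪)) cardₘ₋₁ (proj₁ same))
        (from-injective (𝒩 F (lowerLast 𝔫)) cardₙ₋₁ (proj₂ same)))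
        where
        module R = Raise a i j
        module R′ = Raise a′ i′ j′
        unique = content-unique-∼ {f₀ = R.f₀} {R.g₀} {R′.f₀} {R′.g₀} R.raised-bounded R′.raised-bounded
                   R.raised-monic R′.raised-monic R.isPrimitive R′.isPrimitive f∼ g∼
        same : f₋ i ∼ f₋ i′ × g₋ j ∼ g₋ j′
        same = Content-∼ {f = f₋ i} {g₋ j} {f₋ i′} {g₋ j′} (contents i j) (contents i′ j′)
                 (λ n → proj₁ unique (suc n)) (proj₁ (proj₂ unique)) (proj₂ (proj₂ unique))

      pair-injective : ∀ x y → proj₁ (proj₁ (pair x)) ∼ proj₁ (proj₁ (pair y)) →
                       proj₁ (proj₂ (pair x)) ∼ proj₁ (proj₂ (pair y)) → x ≡ y
      pair-injective (inj₁ x) (inj₁ y) f∼ g∼ = ≡.cong inj₁ (from-injective (𝒫 F 𝔪 𝔫) cardP (f∼ , g∼))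
      pair-injective (inj₁ x) (inj₂ (a , i , j)) f∼ g∼ = contradiction g∼ (coprime≢raised x a i j f∼)
      pair-injective (inj₂ (a , i , j)) (inj₁ y) f∼ g∼ = contradiction
        (Setoid.sym (𝒩 F 𝔫) {Raise.raiseʳ a i j} {proj₂ (proj₁ (from cardP y))} g∼)
        (coprime≢raised y a i j (Setoid.sym (𝒩 F 𝔪) {Raise.raiseˡ a i j} {proj₁ (proj₁ (from cardP y))} f∼))
      pair-injective (inj₂ (a , i , j)) (inj₂ (a′ , i′ , j′)) f∼ g∼ = ≡.cong inj₂ (raise-injective a i j a′ i′ j′ f∼ g∼)

      bound-below : P ℕ.+ q ℕ.* (Nₘ₋₁ ℕ.* Nₙ₋₁) ℕ.≤ Nₘ ℕ.* Nₙ
      bound-below = injection⇒≤ ((↔-id _ ⊎-↔ ((↔-id _ ×-↔ Fin.*↔×) ↔-∘ Fin.*↔×)) ↔-∘ Fin.+↔⊎) Fin.*↔×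
        (λ x → to cardₘ (proj₁ (pair x)) , to cardₙ (proj₂ (pair x)))
        λ x y eq → pair-injective x y
          (to-injective (𝒩 F 𝔪) cardₘ (≡.cong proj₁ eq)) (to-injective (𝒩 F 𝔫) cardₙ (≡.cong proj₂ eq))

    bounds : 0 ℕ.< lookup 𝔪 (fromℕ k) → 0 ℕ.< lookup 𝔫 (fromℕ k) →
             (∀ j → 1 ℕ.< lookup 𝔪 (inject₁ j) ℕ.⊔ lookup 𝔫 (inject₁ j)) →
             ¬ ¬ (Nₘ ℕ.* Nₙ ℕ.≤ P ℕ.+ (q ℕ.^ (errorExponent 𝔪 𝔫 ℕ.+ 3 ℕ.+ suc k) ℕ.+ q ℕ.* (Nₘ₋₁ ℕ.* Nₙ₋₁))
                  × P ℕ.+ q ℕ.* (Nₘ₋₁ ℕ.* Nₙ₋₁) ℕ.≤ Nₘ ℕ.* Nₙ)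
    bounds 0<m 0<n 1<max ¬bounds =
      ¬¬-∀ (λ i → ¬¬-∀ λ j → classify {f = f i} {g j} (proj₂ (from cardₘ i)) (proj₂ (from cardₙ j))) λ kind →
      ¬¬-∀ (λ i → ¬¬-∀ λ j → content-exists _ (f₋ i) (g₋ j) ℕ.≤-refl
                               (proj₂ (proj₂ (from cardₘ₋₁ i)) (fromℕ k))) λ contents →
      ¬bounds (Upper.bound-above 1<max kind , Lower.bound-below 0<m 0<n contents)

-- From the two inequalities to the error term

open import Data.Integer.Base as ℤ using (+_; ∣_∣)
open import Data.Nat.Base using (_+_; _*_; _^_; _⊔_; _≤_; _<_)

-- By `lower` the integer is not positive, so its absolute value is a truncated difference of
-- natural numbers, which `upper` bounds.
distance : ∀ P N Q S → N ℕ.≤ P ℕ.+ (S ℕ.+ Q) → P ℕ.+ Q ℕ.≤ N → ∣ + P ℤ.- (+ N ℤ.- + Q) ∣ ℕ.≤ S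
distance P N Q S upper lower = ≡.subst (ℕ._≤ S) (≡.sym eq)
  (ℕ.m≤n+o⇒m∸n≤o N (P ℕ.+ Q) (≡.subst (N ℕ.≤_)
    (≡.trans (≡.cong (P ℕ.+_) (ℕ.+-comm S Q)) (≡.sym (ℕ.+-assoc P Q S))) upper))
  where
  regroup : ∀ x y z → x ℤ.- (y ℤ.- z) ≡ (x ℤ.+ z) ℤ.- y
  regroup = ℤ.solve-∀
  eq : ∣ + P ℤ.- (+ N ℤ.- + Q) ∣ ≡ N ℕ.∸ (P ℕ.+ Q)
  eq = ≡.trans (≡.cong ∣_∣ (≡.trans (regroup (+ P) (+ N) (+ Q)) (ℤ.m-n≡m⊖n (P ℕ.+ Q) N))) (ℤ.∣⊖∣-≤ lower)

theorem5p8 : ∀ {c ℓ₁ ℓ₂} (q : ℕ) → IsPrimePower q →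
    (k-1 : ℕ) → 2 ≤ suc k-1 →
    ∃[ C ] ((𝔽 : HeytingField c ℓ₁ ℓ₂) → HasCardinality (HeytingField.setoid 𝔽) q →
    (𝔪 𝔫 : Vec ℕ (suc k-1)) →
    0 < lookup 𝔪 (fromℕ k-1) → 0 < lookup 𝔫 (fromℕ k-1) →
    ((i : Fin k-1) → 1 < lookup 𝔪 (inject₁ i) ⊔ lookup 𝔫 (inject₁ i)) →
    (P Nₘ Nₙ Nₘ₋₁ Nₙ₋₁ : ℕ) →
    HasCardinality (𝒫 𝔽 𝔪 𝔫) P →
    HasCardinality (𝒩 𝔽 𝔪) Nₘ → HasCardinality (𝒩 𝔽 𝔫) Nₙ →
    HasCardinality (𝒩 𝔽 (lowerLast 𝔪)) Nₘ₋₁ → HasCardinality (𝒩 𝔽 (lowerLast 𝔫)) Nₙ₋₁ →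
    ∣ + P ℤ.- (+ (Nₘ * Nₙ) ℤ.- + (q * (Nₘ₋₁ * Nₙ₋₁))) ∣ ≤ C * q ^ errorExponent 𝔪 𝔫)
-- The words encoding shared factors have `errorExponent` + 3 + k letters; the last two summands do
-- not depend on the degrees and go into the constant.
theorem5p8 q _ k-1 _ = q ^ (3 + suc k-1) ,
  λ 𝔽 card 𝔪 𝔫 0<m 0<n 1<max P Nₘ Nₙ Nₘ₋₁ Nₙ₋₁ cardP cardₘ cardₙ cardₘ₋₁ cardₙ₋₁ →
  decidable-stable (_ ℕ.≤? _) λ ≰ →
  FiniteField.Counting.bounds 𝔽 card 𝔪 𝔫 cardP cardₘ cardₙ cardₘ₋₁ cardₙ₋₁ 0<m 0<n 1<max λ (upper , lower) →
  ≰ (≡.subst (∣ + P ℤ.- (+ (Nₘ * Nₙ) ℤ.- + (q * (Nₘ₋₁ * Nₙ₋₁))) ∣ ≤_) (exponent (errorExponent 𝔪 𝔫))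
      (distance P (Nₘ * Nₙ) (q * (Nₘ₋₁ * Nₙ₋₁)) _ upper lower))
  where
  exponent : ∀ E → q ^ (E + 3 + suc k-1) ≡ q ^ (3 + suc k-1) * q ^ E
  exponent E = ≡.trans
    (≡.cong (q ^_) (≡.trans (ℕ.+-assoc E 3 (suc k-1)) (ℕ.+-comm E (3 + suc k-1))))
    (ℕ.^-distribˡ-+-* q (3 + suc k-1) E)
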